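{- Let $a<b$ be positive integers and let $\lambda$ be a partition such that $\lambda^{\mathrm{Cr}_{a,b}}$ is a partition. Suppose that every box $(i,j)\in\lambda$ whose hook length $H_{i,j}$ is divisible by $b$ satisfies $$\left(\frac{b}{a}-1\right)l_{i,j} < a_{i,j}+1 .$$ Then $\lambda$ is $b$-regular and $\lambda^{\mathrm{M}_b\mathrm{Tr}}=\lambda^{\mathrm{Cr}_{a,b}}$.
   Context: A partition $\lambda=(\lambda_1\ge\lambda_2\ge\dots\ge\lambda_k>0)$ (with $\lambda_i=0$ for $i>k$, $l(\lambda)=k$, $|\lambda|=\sum\lambda_i$) is identified with its Young diagram $\{(i,j)\in\mathbb{Z}_{>0}^2: j\le\lambda_i\}$ (English convention: $i$ is the row index increasing southwards, $j$ the column index increasing eastwards). $\lambda^{\mathrm{Tr}}$ is the transpose (conjugate) partition. For $(i,j)\in\lambda$: arm $a_{i,j}=\lambda_i-j$, leg $l_{i,j}=\lambda^{\mathrm{Tr}}_j-i$, hook length $H_{i,j}=1+a_{i,j}+l_{i,j}$. $\lambda$ is $b$-regular if there is no $i$ with $\lambda_i=\lambda_{i+1}=\dots=\lambda_{i+b-1}>0$. Ladders and column regularization: for $(x,y)\in\mathbb{Z}^2$, the ladder $\ell_{x,y}=\{(i,j)\in\mathbb{Z}_{>0}^2:\exists t\in\mathbb{Z},\ i=x-ta,\ j=y+t(b-a)\}$. The distinct ladders partition $\mathbb{Z}_{>0}^2$ into finite sets. $\lambda^{\mathrm{Cr}_{a,b}}$ is the set obtained by replacing, for each ladder $\ell$,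 the set $\lambda\cap\ell$ by the $|\lambda\cap\ell|$ points of $\ell$ with the largest first coordinates (i.e. sliding the boxes southwards along the ladder to the bottom); it need not be a partition. Rim and $b$-rim (for $b$-regular $\lambda$): the rim is $\{(i,j)\in\lambda:(i+1,j+1)\notin\lambda\}$, a connected path of boxes traversed from $(1,\lambda_1)$ southwestwards to $(l(\lambda),1)$. The $b$-rim is the union of pieces chosen as follows: the first piece consists of $b$ consecutive rim boxes starting at $(1,\lambda_1)$ moving southwestwards along the rim; if the last box of a piece lies in row $i_0$, the next piece consists of $b$ consecutive rim boxes starting at the rightmost box $(i_0+1,\lambda_{i_0+1})$ of row $i_0+1$; continue until reaching the last row (the final piece may have fewer than $b$ boxes). Let $\lambda^{\mathrm{I}_b}=(\mu_1,\dots,\mu_k)$ (trailing zeros allowed) be $\lambda$ with its $b$-rim removed, $\phi=|\lambda|-|\lambda^{\mathrm{I}_b}|$, and define $\lambda^{\mathrm{J}_b}=(\mu_1+1,\dots,\mu_{k-1}+1,\mu_k+\delta)$ where $\delta=1$ if $b\mid\phi$ and $\delta=0$ otherwise. For $b$-regular $\lambda$, $\lambda^{\mathrm{M}_b\mathrm{Tr}}=(j_1,\dots,j_l)$ where $j_i=|\lambda^{\mathrm{J}_b^{i-1}}|-|\lambda^{\mathrm{J}_b^{i}}|$ (iterating $\mathrm{J}_b$ until the empty partition is reached); this is the composition of the Mullineux map $\mathrm{M}_b$ with transposition. -}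

module Defs where

open import Data.Nat using (ℕ; zero; suc; _+_; _*_; _∸_; _≤_; _<_; _≤ᵇ_; _⊔_)
open import Data.Nat.Divisibility using (_∣_; _∣?_)
open import Data.Bool using (Bool; true; false; if_then_else_; _∧_)
open import Data.List using (List; []; _∷_; length; filterᵇ; reverse; _++_)
open import Data.Nat.ListAction using (sum)
open import Data.Product using (_×_; _,_; Σ; ∃; proj₁)
open import Data.Empty using (⊥)
open import Relation.Nullary using (¬_; does)
open import Relation.Binary.PropositionalEquality using (_≡_)
open import Data.List.Relation.Unary.All using (All)
open import Data.List.Relation.Unary.Linked using (Linked)
open import Data.Nat using (_≥_)

IsPartition : List ℕ → Set
IsPartition λs = Linked _≥_ λs × All (λ x → 0 < x) λs

-- λ_i, 1-indexed, with λ_i = 0 for i > l(λ) (and for i = 0)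
part : List ℕ → ℕ → ℕ
part []       _             = 0
part (x ∷ xs) zero          = 0
part (x ∷ xs) (suc zero)    = x
part (x ∷ xs) (suc (suc n)) = part xs (suc n)

InDiag : List ℕ → ℕ → ℕ → Set
InDiag λs i j = 1 ≤ i × 1 ≤ j × j ≤ part λs i

inDiagᵇ : List ℕ → ℕ × ℕ → Bool
inDiagᵇ λs (i , j) = (1 ≤ᵇ i) ∧ ((1 ≤ᵇ j) ∧ (j ≤ᵇ part λs i))

conj : List ℕ → ℕ → ℕ
conj λs j = length (filterᵇ (λ x → j ≤ᵇ x) λs)

arm : List ℕ → ℕ → ℕ → ℕ
arm λs i j = part λs i ∸ j

leg : List ℕ → ℕ → ℕ → ℕ
leg λs i j = conj λs j ∸ i

hook : List ℕ → ℕ → ℕ → ℕ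
hook λs i j = 1 + arm λs i j + leg λs i j

Regular : ℕ → List ℕ → Set
Regular b λs = ¬ (Σ ℕ λ i → 1 ≤ i × 0 < part λs i
                  × ((t : ℕ) → t < b → part λs (i + t) ≡ part λs i))

-- points (x + s a , y - s d), s = 1, 2, … with positive coordinates
-- (the ladder points strictly south of (x , y)); fuel y suffices as d ≥ 1
ladderBelow : ℕ → ℕ → ℕ → ℕ → ℕ → List (ℕ × ℕ)
ladderBelow a b zero     x y = []
ladderBelow a b (suc f) x y =
  if suc (b ∸ a) ≤ᵇ y
  then (x + a , y ∸ (b ∸ a)) ∷ ladderBelow a b f (x + a) (y ∸ (b ∸ a))
  else []

-- points (x - t a , y + t d), t = 1, 2, … with positive coordinates
-- (the ladder points strictly north of (x , y)); fuel x suffices as a ≥ 1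
ladderAbove : ℕ → ℕ → ℕ → ℕ → ℕ → List (ℕ × ℕ)
ladderAbove a b zero     x y = []
ladderAbove a b (suc f) x y =
  if suc a ≤ᵇ x
  then (x ∸ a , y + (b ∸ a)) ∷ ladderAbove a b f (x ∸ a) (y + (b ∸ a))
  else []

ladder : ℕ → ℕ → ℕ → ℕ → List (ℕ × ℕ)
ladder a b x y = reverse (ladderBelow a b y x y) ++ ((x , y) ∷ ladderAbove a b x x y)

ladderCount : ℕ → ℕ → List ℕ → ℕ → ℕ → ℕ
ladderCount a b λs x y = length (filterᵇ (inDiagᵇ λs) (ladder a b x y))

-- (x , y) ∈ λ^{Cr_{a,b}}  iff  (x , y) is among the |λ ∩ ℓ_{x,y}| points of
-- ℓ_{x,y} with largest first coordinates, i.e. fewer than |λ ∩ ℓ_{x,y}|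
-- points of the ladder lie strictly south of it.
InCr : ℕ → ℕ → List ℕ → ℕ → ℕ → Set
InCr a b λs x y = 1 ≤ x × 1 ≤ y × length (ladderBelow a b y x y) < ladderCount a b λs x y

head0 : List ℕ → ℕ
head0 []      = 0
head0 (x ∷ _) = x

-- removeRim b r λ : λ with its b-rim removed, where r is the number of boxes
-- still to be taken by the current piece.  The rim boxes in row i are the
-- columns max(1, λ_{i+1}) … λ_i, traversed from right to left, i.e.
-- c_i = λ_i + 1 - max(1, λ_{i+1}) boxes; consecutive rows' segments are adjacent.
-- Each piece starts at the rightmost box of a row.
removeRim : ℕ → ℕ → List ℕ → List ℕ
removeRim b r []       = []
removeRim b r (x ∷ xs) =
  let c = suc x ∸ (1 ⊔ head0 xs) in
  if r ≤ᵇ c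
  then (x ∸ r) ∷ removeRim b b xs
  else (x ∸ c) ∷ removeRim b (r ∸ c) xs

-- λ^{I_b} = (μ_1, …, μ_k)  (trailing zeros kept)
Ib : ℕ → List ℕ → List ℕ
Ib b λs = removeRim b b λs

bump : ℕ → List ℕ → List ℕ
bump δ []           = []
bump δ (m ∷ [])     = (m + δ) ∷ []
bump δ (m ∷ (n ∷ ms)) = suc m ∷ bump δ (n ∷ ms)

stripZ : List ℕ → List ℕ
stripZ []       = []
stripZ (x ∷ xs) with stripZ xs
... | [] = if x ≤ᵇ 0 then [] else x ∷ []
... | r@(_ ∷ _) = x ∷ r

Jb : ℕ → List ℕ → List ℕ
Jb b λs =
  let μ = Ib b λs
      φ = sum λs ∸ sum μ
      δ = if does (b ∣? φ) then 1 else 0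
  in stripZ (bump δ μ)

-- iterate J_b until the empty partition, recording the size drops
-- (fuel = |λ|, enough since each step strictly decreases the size)
mbtrGo : ℕ → ℕ → List ℕ → List ℕ
mbtrGo b zero    _         = []
mbtrGo b (suc f) []        = []
mbtrGo b (suc f) (x ∷ xs)  = (sum (x ∷ xs) ∸ sum (Jb b (x ∷ xs))) ∷ mbtrGo b f (Jb b (x ∷ xs))

MbTr : ℕ → List ℕ → List ℕ
MbTr b λs = mbtrGo b (sum λs) λs

{-# OPTIONS --safe #-}
-- Put d = b − a and number rows and columns from 0, with r i the length of row i.
-- The hypothesis says that a hook of length m b has leg < m a.  Row 0 of the
-- regularization consists of the columns y < min_q (r (q a) + q d), and the fact
-- that the regularization is a partition yields removable boxes in rows v a − 1.
-- Follow the pieces of the b-rim: if piece P + 1 starts in row s, set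
-- K = r s − s + P b.  Then K is weakly decreasing in P, and it can only drop when a
-- b-divisible hook ends there; at a drop the hook bound gives s ≤ P a, while the
-- removable boxes always give s ≥ P a.  Hence in every row i the value of K is the minimum of
-- r (q a) + q d over q a ≤ i, which describes J_b without reference to pieces.
-- From this description J_b inherits the hook bound, it removes row 0 from the
-- regularization, and |λ| − |J_b λ| is the length of that row; iterate.
module Submission where

open import Defs
open import Data.Nat using (ℕ)
open import Data.Bool using (Bool; true; false; if_then_else_; T)
open import Data.Empty using (⊥; ⊥-elim)
open import Data.List using (List; []; _∷_; _++_; length; reverse; filterᵇ; _∷ʳ_)
open import Data.List.Properties using (unfold-reverse; length-++; length-reverse)
open import Data.List.Relation.Unary.All as All using (All)
open import Data.List.Relation.Unary.Linked as Linked using (Linked)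
open import Data.Nat.ListAction using (sum)
open import Data.Product using (_×_; _,_; ∃; proj₁; proj₂)
open import Data.Sum using (_⊎_; inj₁; inj₂)
open import Function using (_∘_)
open import Relation.Binary.PropositionalEquality using (_≡_; _≢_; refl; sym; trans; cong; cong₂; subst; subst₂; module ≡-Reasoning)
open import Relation.Nullary using (¬_; yes; no; does)
open import Relation.Nullary.Decidable using (dec-true; dec-false)

-- Linear arithmetic, indicators and finite sums.

module Sums where

  open import Data.Nat
  open import Data.Nat.Properties
  open import Data.Nat.Tactic.RingSolver using (solve)

  infixl 5 _⊕_
  _⊕_ : ∀ {m n o p} → m ≤ n → o ≤ p → m + o ≤ n + p
  _⊕_ = +-mono-≤

  -- Linear consequences of a sum l ≤ r of hypotheses reduce to a semiring identity.
  lin : ∀ {x y l r} → l ≤ r → x + r ≡ y + l → x ≤ y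
  lin {x} {y} {l} {r} h e = +-cancelʳ-≤ r x y (≤-trans (≤-reflexive e) (+-monoʳ-≤ y h))

  eqlin : ∀ {x y l r} → l ≡ r → x + r ≡ y + l → x ≡ y
  eqlin {x} {y} {l} refl e = +-cancelʳ-≡ l x y e

  ≤ᵇ-true : ∀ {m n} → m ≤ n → (m ≤ᵇ n) ≡ true
  ≤ᵇ-true {m} {n} m≤n with m ≤ᵇ n | ≤⇒≤ᵇ m≤n
  ... | true | _ = refl

  ≤ᵇ-false : ∀ {m n} → n < m → (m ≤ᵇ n) ≡ false
  ≤ᵇ-false {m} {n} n<m with m ≤ᵇ n in eq
  ... | false = refl
  ... | true  = ⊥-elim (<⇒≱ n<m (≤ᵇ⇒≤ m n (subst T (sym eq) _)))

  ind : ℕ → ℕ → ℕ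
  ind x y = if x ≤ᵇ y then 1 else 0

  ind-yes : ∀ {x y} → x ≤ y → ind x y ≡ 1
  ind-yes x≤y = cong (if_then 1 else 0) (≤ᵇ-true x≤y)

  ind-no : ∀ {x y} → y < x → ind x y ≡ 0
  ind-no y<x = cong (if_then 1 else 0) (≤ᵇ-false y<x)

  ind≤1 : ∀ x y → ind x y ≤ 1
  ind≤1 x y with x ≤ᵇ y
  ... | false = z≤n
  ... | true  = ≤-refl

  ind-cong : ∀ {x y x′ y′} → (x ≤ y → x′ ≤ y′) → (x′ ≤ y′ → x ≤ y) → ind x y ≡ ind x′ y′
  ind-cong {x} {y} to from with x ≤? y
  ... | yes x≤y = trans (ind-yes x≤y) (sym (ind-yes (to x≤y)))
  ... | no  x≰y = trans (ind-no (≰⇒> x≰y)) (sym (ind-no (≰⇒> (x≰y ∘ from))))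

  ind-< : ∀ {x y x′ y′} → ind x y < ind x′ y′ → y < x × x′ ≤ y′
  ind-< {x} {y} {x′} {y′} lt with x ≤? y | x′ ≤? y′
  ... | yes x≤y | _         = ⊥-elim (<⇒≱ lt (≤-trans (ind≤1 x′ y′) (≤-reflexive (sym (ind-yes x≤y)))))
  ... | no  x≰y | yes x′≤y′ = ≰⇒> x≰y , x′≤y′
  ... | no  _   | no  x′≰y′ = ⊥-elim (<⇒≱ lt (≤-trans (≤-reflexive (ind-no (≰⇒> x′≰y′))) z≤n))

  sumTo : ℕ → (ℕ → ℕ) → ℕ
  sumTo zero    g = 0
  sumTo (suc n) g = g 0 + sumTo n (g ∘ suc)

  sumTo-cong : ∀ n {g h} → (∀ t → g t ≡ h t) → sumTo n g ≡ sumTo n h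
  sumTo-cong zero    eq = refl
  sumTo-cong (suc n) eq = cong₂ _+_ (eq 0) (sumTo-cong n (eq ∘ suc))

  sumTo-zero : ∀ n {g} → (∀ t → g t ≡ 0) → sumTo n g ≡ 0
  sumTo-zero zero    eq = refl
  sumTo-zero (suc n) eq = cong₂ _+_ (eq 0) (sumTo-zero n (eq ∘ suc))

  sumTo-tail : ∀ n k {g} → (∀ t → n ≤ t → g t ≡ 0) → sumTo (n + k) g ≡ sumTo n g
  sumTo-tail zero    k eq = sumTo-zero k (λ t → eq t z≤n)
  sumTo-tail (suc n) k eq = cong (_ +_) (sumTo-tail n k (λ t n≤t → eq (suc t) (s≤s n≤t)))

  sumTo-≤ : ∀ n {g} → (∀ t → g t ≤ 1) → sumTo n g ≤ n
  sumTo-≤ zero    h = z≤n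
  sumTo-≤ (suc n) h = +-mono-≤ (h 0) (sumTo-≤ n (h ∘ suc))

  sumTo-term : ∀ n {g t} → t < n → g t ≤ sumTo n g
  sumTo-term (suc n) {g} {zero}  _         = m≤m+n _ _
  sumTo-term (suc n) {g} {suc t} (s≤s t<n) = ≤-trans (sumTo-term n t<n) (m≤n+m _ (g 0))

  sumTo-< : ∀ n {g h} → sumTo n g < sumTo n h → ∃ λ t → g t < h t
  sumTo-< (suc n) {g} {h} lt with g 0 <? h 0
  ... | yes g<h = 0 , g<h
  ... | no  g≮h with sumTo-< n {g ∘ suc} {h ∘ suc} (+-cancelˡ-< (g 0) _ _ (<-≤-trans lt (+-monoˡ-≤ _ (≮⇒≥ g≮h))))
  ...   | t , gt<ht = suc t , gt<ht

  sumTo-telescope : ∀ n {x y w : ℕ → ℕ} → (∀ t → x t + w t ≡ y t + w (suc t)) → sumTo n x + w 0 ≡ sumTo n y + w n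
  sumTo-telescope zero    eq = refl
  sumTo-telescope (suc n) {x} {y} {w} eq =
    shuffle (x 0) (w 0) (y 0) (w 1) (sumTo n (x ∘ suc)) (sumTo n (y ∘ suc)) (w (suc n))
      (eq 0) (sumTo-telescope n {x ∘ suc} {y ∘ suc} {w ∘ suc} (eq ∘ suc))
    where
    shuffle : ∀ x₀ w₀ y₀ w₁ sx sy wₙ → x₀ + w₀ ≡ y₀ + w₁ → sx + w₁ ≡ sy + wₙ → x₀ + sx + w₀ ≡ y₀ + sy + wₙ
    shuffle x₀ w₀ y₀ w₁ sx sy wₙ e f =
      eqlin (cong₂ _+_ e f) (solve (x₀ ∷ w₀ ∷ y₀ ∷ w₁ ∷ sx ∷ sy ∷ wₙ ∷ []))

  sumTo-snoc : ∀ n g → sumTo (suc n) g ≡ sumTo n g + g n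
  sumTo-snoc zero    g = +-comm (g 0) 0
  sumTo-snoc (suc n) g = trans (cong (g 0 +_) (sumTo-snoc n (g ∘ suc))) (sym (+-assoc (g 0) _ _))

  sumTo-+ : ∀ m n g → sumTo (m + n) g ≡ sumTo m g + sumTo n (λ t → g (m + t))
  sumTo-+ zero    n g = refl
  sumTo-+ (suc m) n g = trans (cong (g 0 +_) (sumTo-+ m n (g ∘ suc))) (sym (+-assoc (g 0) _ _))

-- Row lengths, rim removal, column ends and counting absent boxes.

module Rows where

  open import Data.Nat
  open import Data.Nat.Properties
  open Sums

  -- Rows are numbered from 0, so that the length of row i of λs is part λs (suc i).
  Anti : (ℕ → ℕ) → Set
  Anti r = ∀ i → r (suc i) ≤ r i

  anti-≤ : ∀ r → Anti r → ∀ {i j} → i ≤ j → r j ≤ r i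
  anti-≤ r an i≤j = go (≤⇒≤′ i≤j)
    where
    go : ∀ {i j} → i ≤′ j → r j ≤ r i
    go ≤′-refl       = ≤-refl
    go (≤′-step i≤j) = ≤-trans (an _) (go i≤j)

  row : List ℕ → ℕ → ℕ
  row λs i = part λs (suc i)

  sum-stripZ : ∀ xs → sum (stripZ xs) ≡ sum xs
  sum-stripZ []       = refl
  sum-stripZ (x ∷ xs) with stripZ xs | sum-stripZ xs
  sum-stripZ (zero  ∷ xs) | []    | eq = eq
  sum-stripZ (suc x ∷ xs) | []    | eq = cong (suc x +_) eq
  sum-stripZ (x ∷ xs)     | _ ∷ _ | eq = cong (x +_) eq

  row-stripZ : ∀ xs i → row (stripZ xs) i ≡ row xs i
  row-stripZ []       i = refl
  row-stripZ (x ∷ xs) i with stripZ xs | row-stripZ xs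
  row-stripZ (zero  ∷ xs) zero    | []    | eq = refl
  row-stripZ (zero  ∷ xs) (suc i) | []    | eq = eq i
  row-stripZ (suc x ∷ xs) zero    | []    | eq = refl
  row-stripZ (suc x ∷ xs) (suc i) | []    | eq = eq i
  row-stripZ (x ∷ xs)     zero    | _ ∷ _ | eq = refl
  row-stripZ (x ∷ xs)     (suc i) | _ ∷ _ | eq = eq i

  stripZ-positive : ∀ xs → Anti (row xs) → All (0 <_) (stripZ xs)
  stripZ-positive []       anti = All.[]
  stripZ-positive (x ∷ xs) anti with stripZ xs | row-stripZ xs | stripZ-positive xs (anti ∘ suc)
  stripZ-positive (zero  ∷ xs) anti | []    | _  | _         = All.[]
  stripZ-positive (suc x ∷ xs) anti | []    | _  | _         = s≤s z≤n All.∷ All.[]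
  stripZ-positive (x ∷ xs)     anti | _ ∷ _ | eq | 0<y All.∷ pos =
    <-≤-trans 0<y (≤-trans (≤-reflexive (eq 0)) (anti 0)) All.∷ 0<y All.∷ pos

  removeRim-end : ∀ b r x xs → r ≤ suc x ∸ (1 ⊔ head0 xs) →
    removeRim b r (x ∷ xs) ≡ (x ∸ r) ∷ removeRim b b xs
  removeRim-end b r x xs h = cong (λ t → if t then (x ∸ r) ∷ removeRim b b xs
    else (x ∸ (suc x ∸ (1 ⊔ head0 xs))) ∷ removeRim b (r ∸ (suc x ∸ (1 ⊔ head0 xs))) xs) (≤ᵇ-true h)

  removeRim-continue : ∀ b r x xs → suc x ∸ (1 ⊔ head0 xs) < r →
    removeRim b r (x ∷ xs) ≡ (x ∸ (suc x ∸ (1 ⊔ head0 xs))) ∷ removeRim b (r ∸ (suc x ∸ (1 ⊔ head0 xs))) xs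
  removeRim-continue b r x xs h = cong (λ t → if t then (x ∸ r) ∷ removeRim b b xs
    else (x ∸ (suc x ∸ (1 ⊔ head0 xs))) ∷ removeRim b (r ∸ (suc x ∸ (1 ⊔ head0 xs))) xs) (≤ᵇ-false h)

  -- `bump` must see that the tail is nonempty, but `removeRim` hides its head behind a comparison.
  bump-removeRim : ∀ δ m b r x xs →
    bump δ (m ∷ removeRim b r (x ∷ xs)) ≡ suc m ∷ bump δ (removeRim b r (x ∷ xs))
  bump-removeRim δ m b r x xs with r ≤ᵇ (suc x ∸ (1 ⊔ head0 xs))
  ... | true  = refl
  ... | false = refl

  linked⇒anti : ∀ {λs} → Linked _≥_ λs → Anti (row λs)
  linked⇒anti Linked.[]            i       = z≤n
  linked⇒anti Linked.[-]           i       = z≤n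
  linked⇒anti (x≥y Linked.∷ rest)  zero    = x≥y
  linked⇒anti (x≥y Linked.∷ rest)  (suc i) = linked⇒anti rest i

  row-beyond : ∀ λs i → length λs ≤ i → row λs i ≡ 0
  row-beyond []       i       _         = refl
  row-beyond (x ∷ xs) (suc i) (s≤s len) = row-beyond xs i len

  conj-zero : ∀ λs j → Anti (row λs) → row λs 0 ≤ j → conj λs (suc j) ≡ 0
  conj-zero []       j anti h = refl
  conj-zero (x ∷ xs) j anti h rewrite ≤ᵇ-false {suc j} {x} (s≤s h) = conj-zero xs j (anti ∘ suc) (≤-trans (anti 0) h)

  conj-corner : ∀ λs j e → Anti (row λs) → j < row λs e → row λs (suc e) ≤ j → conj λs (suc j) ≡ suc e
  conj-corner (x ∷ xs) j zero    anti above below rewrite ≤ᵇ-true above = cong suc (conj-zero xs j (anti ∘ suc) below)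
  conj-corner (x ∷ xs) j (suc e) anti above below
    rewrite ≤ᵇ-true (≤-trans above (anti-≤ (row (x ∷ xs)) anti (z≤n {suc e}))) = cong suc (conj-corner xs j e (anti ∘ suc) above below)

  column-end : ∀ (r : ℕ → ℕ) n i j → j < r i → r (i + n) ≤ j → ∃ λ e → i ≤ e × j < r e × r (suc e) ≤ j
  column-end r zero    i j above below = ⊥-elim (<⇒≱ above (subst (λ k → r k ≤ j) (+-identityʳ i) below))
  column-end r (suc n) i j above below with j <? r (suc i)
  ... | no  j≮ = i , ≤-refl , above , ≮⇒≥ j≮
  ... | yes j< with column-end r n (suc i) j j< (subst (λ k → r k ≤ j) (+-suc i n) below)
  ...   | e , i<e , rest = e , <⇒≤ i<e , rest

  -- Membership in the regularization compares the boxes present with the points to the south;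
  -- counting absences turns this into a bound by the number of points to the north.
  misses : {A : Set} → (A → Bool) → List A → ℕ
  misses p []       = 0
  misses p (x ∷ xs) = (if p x then 0 else 1) + misses p xs

  filter+misses : ∀ {A : Set} (p : A → Bool) xs → length (filterᵇ p xs) + misses p xs ≡ length xs
  filter+misses p []       = refl
  filter+misses p (x ∷ xs) with p x
  ... | true  = cong suc (filter+misses p xs)
  ... | false = trans (+-suc _ _) (cong suc (filter+misses p xs))

  misses-++ : ∀ {A : Set} (p : A → Bool) xs ys → misses p (xs ++ ys) ≡ misses p xs + misses p ys
  misses-++ p []       ys = refl
  misses-++ p (x ∷ xs) ys = trans (cong (_ +_) (misses-++ p xs ys)) (sym (+-assoc (if p x then 0 else 1) _ _))

  misses-reverse : ∀ {A : Set} (p : A → Bool) xs → misses p (reverse xs) ≡ misses p xs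
  misses-reverse p []       = refl
  misses-reverse p (x ∷ xs) = begin
    misses p (reverse (x ∷ xs))                          ≡⟨ cong (misses p) (unfold-reverse x xs) ⟩
    misses p (reverse xs ∷ʳ x)                           ≡⟨ misses-++ p (reverse xs) (x ∷ []) ⟩
    misses p (reverse xs) + ((if p x then 0 else 1) + 0) ≡⟨ cong₂ _+_ (misses-reverse p xs) (+-identityʳ _) ⟩
    misses p xs + (if p x then 0 else 1)                 ≡⟨ +-comm (misses p xs) _ ⟩
    misses p (x ∷ xs)                                    ∎
    where open ≡-Reasoning

  miss-point : ∀ λs i y → (if inDiagᵇ λs (suc i , suc y) then 0 else 1) ≡ ind (row λs i) y
  miss-point λs i y with y <? row λs i
  ... | yes y<r = trans (cong (if_then 0 else 1) (≤ᵇ-true y<r)) (sym (ind-no y<r))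
  ... | no  y≮r = trans (cong (if_then 0 else 1) (≤ᵇ-false (s≤s (≮⇒≥ y≮r)))) (sym (ind-yes (≮⇒≥ y≮r)))

-- Ladders, their missing boxes, and corners.

module Ladders (a′ d′ : ℕ) where

  open import Data.Nat
  open import Data.Nat.Properties
  open import Data.Nat.Divisibility using (_∣_; _∣?_; divides; ∣⇒≤; ∣m+n∣m⇒∣n)
  open import Data.Nat.Tactic.RingSolver using (solve)
  open import Function.Bundles using (_⇔_; Equivalence)
  import Data.Integer as ℤ
  import Data.Integer.Properties as ℤ
  import Data.Rational as ℚ
  import Data.Rational.Properties as ℚ
  import Data.Rational.Unnormalised as ℚᵘ
  import Data.Rational.Unnormalised.Properties as ℚᵘ
  open Sums
  open Rows

  a d b : ℕ
  a = suc a′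
  d = suc d′
  b = a + d

  -- The column in which the ladder through the first empty cell of row `q * a` meets row 0.
  level : (ℕ → ℕ) → ℕ → ℕ
  level r q = r (q * a) + q * d

  -- The box (i , j), in a column j whose last row is e, has hook length m b only if
  -- its leg e − i is less than m a.
  HookCond : (ℕ → ℕ) → Set
  HookCond r = ∀ i e j m → i ≤ e → j < r e → r (suc e) ≤ j →
    r i + suc e ≡ m * b + (i + suc j) → e < i + m * a

  gap : (ℕ → ℕ) → ℕ → ℕ → ℕ → ℕ
  gap r i Y t = ind (r (i + t * a) + t * d) Y

  -- The number of boxes missing from the ladder with northernmost box (i , Y).  Points
  -- of index t with t d > Y lie outside the quadrant and contribute 0, so any
  -- sufficiently long range of summation will do.
  deficit : (ℕ → ℕ) → ℕ → ℕ → ℕ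
  deficit r i Y = sumTo (suc Y) (gap r i Y)

  m≤m*d : ∀ n → n ≤ n * d
  m≤m*d n = m≤m*n n d

  gap-zero : ∀ r i {Y} t → Y < t * d → gap r i Y t ≡ 0
  gap-zero r i t lt = ind-no (<-≤-trans lt (m≤n+m _ (r (i + t * a))))

  deficit-tail : ∀ r i {Y} N → Y < N * d → sumTo N (gap r i Y) ≡ deficit r i Y
  deficit-tail r i {Y} N lt = begin
    sumTo N (gap r i Y)             ≡⟨ sumTo-tail N (suc Y) (λ t N≤t → gap-zero r i t (<-≤-trans lt (*-monoˡ-≤ d N≤t))) ⟨
    sumTo (N + suc Y) (gap r i Y)   ≡⟨ cong (λ n → sumTo n (gap r i Y)) (+-comm N (suc Y)) ⟩
    sumTo (suc Y + N) (gap r i Y)   ≡⟨ sumTo-tail (suc Y) N (λ t Y<t → gap-zero r i t (<-≤-trans Y<t (m≤m*d t))) ⟩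
    deficit r i Y                   ∎
    where open ≡-Reasoning

  -- After sliding south, the first `deficit` points of a ladder are empty.
  Regularizes : (ℕ → ℕ) → (ℕ → ℕ) → Set
  Regularizes r s = ∀ i u y → i < a →
    (deficit r i (y + u * d) ≤ u → y < s (i + u * a)) × (y < s (i + u * a) → deficit r i (y + u * d) ≤ u)

  -- The rows a′ + v * a and suc v * a are adjacent since a = suc a′.
  Cornered : (ℕ → ℕ) → Set
  Cornered r = ∀ Y q → Y < r 0 → level r q ≤ Y →
    ∃ λ v → level r (suc v) ≤ Y × Y < r (a′ + v * a) + suc v * d

  deficit-pos : ∀ r {Y} q → level r q ≤ Y → 1 ≤ deficit r 0 Y
  deficit-pos r {Y} q h = ≤-trans (≤-reflexive (sym (ind-yes h)))
    (sumTo-term (suc Y) {gap r 0 Y} (s≤s (≤-trans (m≤m*d q) (≤-trans (m≤n+m _ _) h))))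

  -- The regularized ladder of (0 , Y) starts in row suc u * a, so the row just above is
  -- occupied in the same column.  Hence the ladder of (a′ , Y − d), which runs directly
  -- above, has fewer missing boxes, and the two ladders differ at a corner.
  regularizes⇒cornered : ∀ r s → Anti s → Regularizes r s → Cornered r
  regularizes⇒cornered r s anti reg Y q Y<r₀ hq with deficit r 0 Y in eq
  ... | zero  = ⊥-elim (<⇒≱ (deficit-pos r q hq) (≤-reflexive eq))
  ... | suc u = t , proj₂ found ,
      <-≤-trans (subst (_< r (a′ + t * a) + t * d + d) Y′+d (+-monoˡ-< d (proj₁ found))) (≤-reflexive (rearrange _ t d))
    where
    first : gap r 0 Y 0 ≡ 0
    first = ind-no (<-≤-trans Y<r₀ (m≤m+n _ _))
    -- Otherwise only indices up to `u` could contribute, and index 0 contributes nothing, so the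
    -- deficit would be at most `u`.
    long : suc u * d ≤ Y
    long = ≮⇒≥ λ lt → <⇒≱ (n<1+n u) (subst (_≤ u)
      (trans (cong (_+ sumTo u (gap r 0 Y ∘ suc)) (sym first)) (trans (deficit-tail r 0 (suc u) lt) eq))
      (sumTo-≤ u (λ t → ind≤1 (level r (suc t)) Y)))
    y = Y ∸ suc u * d
    y-eq : y + suc u * d ≡ Y
    y-eq = m∸n+n≡m long
    Y′ = y + u * d
    Y′+d : Y′ + d ≡ Y
    Y′+d = trans (shift y u d) y-eq
      where
      shift : ∀ y u d → y + u * d + d ≡ y + suc u * d
      shift y u d = solve (y ∷ u ∷ d ∷ [])
    inside : y < s (suc (a′ + u * a))
    inside = proj₁ (reg 0 (suc u) y (s≤s z≤n)) (subst (λ Z → deficit r 0 Z ≤ suc u) (sym y-eq) (≤-reflexive eq))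
    small : deficit r a′ Y′ ≤ u
    small = proj₂ (reg a′ u y ≤-refl) (<-≤-trans inside (anti _))
    Y′<Y : Y′ < Y
    Y′<Y = subst (Y′ <_) Y′+d (m<m+n Y′ (s≤s z≤n))
    strict : sumTo Y (gap r a′ Y′) < sumTo Y (gap r 0 Y ∘ suc)
    strict = subst₂ _<_
      (sym (deficit-tail r a′ Y (<-≤-trans Y′<Y (m≤m*d Y))))
      (trans (sym eq) (cong (_+ sumTo Y (gap r 0 Y ∘ suc)) first))
      (s≤s small)
    t = proj₁ (sumTo-< Y strict)
    found : Y′ < r (a′ + t * a) + t * d × level r (suc t) ≤ Y
    found = ind-< (proj₂ (sumTo-< Y strict))
    rearrange : ∀ x t d → x + t * d + d ≡ x + suc t * d
    rearrange x t d = solve (x ∷ t ∷ d ∷ [])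

  -- Running minima of levels, and inheritance of the hook bound.

  IsMin : (ℕ → ℕ) → ℕ → ℕ → Set
  IsMin r i K = (∀ q → q * a ≤ i → K ≤ level r q) × (∃ λ g → g * a ≤ i × K ≡ level r g)

  min-anti : ∀ r {i i′ K K′} → i ≤ i′ → IsMin r i K → IsMin r i′ K′ → K′ ≤ K
  min-anti r i≤i′ (_ , g , ga≤i , refl) (low , _) = low g (≤-trans ga≤i i≤i′)

  min-unique : ∀ r {i K K′} → IsMin r i K → IsMin r i K′ → K ≡ K′
  min-unique r h h′ = ≤-antisym (min-anti r ≤-refl h′ h) (min-anti r ≤-refl h h′)

  -- y is the length of row i of J_b; it exceeds r (suc i) exactly when the minimum drops.
  SuccessorRow : (ℕ → ℕ) → ℕ → ℕ → Set
  SuccessorRow r i y = ∃ λ K → ∃ λ K′ → IsMin r i K × IsMin r (suc i) K′ × y + K′ ≡ r (suc i) + K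

  Successor : (ℕ → ℕ) → (ℕ → ℕ) → Set
  Successor r J = ∀ i → SuccessorRow r i (J i)

  Jump : (ℕ → ℕ) → (ℕ → ℕ) → ℕ → Set
  Jump r J i = ∃ λ p → ∃ λ K → p * a ≡ suc i × IsMin r i K × J i + p * d ≡ K

  -- The minimum changes between rows `i` and `suc i` only when `suc i` is a multiple `g * a` whose
  -- level is the new minimum; then `r (suc i)` cancels, leaving the old minimum less `g * d`.
  shift-or-jump : ∀ r J → Successor r J → ∀ i → J i ≡ r (suc i) ⊎ Jump r J i
  shift-or-jump r J suc-J i with suc-J i
  ... | K , K′ , min , min′@(_ , g , ga≤1+i , refl) , eq with level r g ≟ K
  ...   | yes refl = inj₁ (+-cancelʳ-≡ (level r g) _ _ eq)
  ...   | no  K′≢K = inj₂ (g , K , ga≡ , min ,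
            cancel (J i) (r (g * a)) (r (suc i)) (g * d) K (cong r ga≡) eq)
    where
    ga≡ : g * a ≡ suc i
    ga≡ = ≤-antisym ga≤1+i (≰⇒> λ ga≤i → K′≢K (≤-antisym (min-anti r (n≤1+n i) min min′) (proj₁ min g ga≤i)))
    cancel : ∀ j x y z K → x ≡ y → j + (x + z) ≡ y + K → j + z ≡ K
    cancel j x .x z K refl e = eqlin e (solve (j ∷ x ∷ z ∷ K ∷ []))

  successor-≥ : ∀ r J → Successor r J → ∀ i → r (suc i) ≤ J i
  successor-≥ r J suc-J i with suc-J i
  ... | K , K′ , min , min′ , eq =
    +-cancelʳ-≤ K _ _ (≤-trans (≤-reflexive (sym eq)) (+-monoʳ-≤ (J i) (min-anti r (n≤1+n i) min min′)))

  -- Each end of the hook lies in a row that shifts or jumps. If the bottom shifts, the hook comes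
  -- from one of `r` whose top is one row lower or in the row attaining the minimum. If the bottom
  -- jumps, comparing levels bounds the leg directly.
  hook-successor : ∀ r J → Anti r → Anti J → Successor r J → HookCond r → HookCond J
  hook-successor r J anti-r anti-J suc-J hook i e j m i≤e j<Je Je≤j eq
    with shift-or-jump r J suc-J i | shift-or-jump r J suc-J e
  ... | inj₁ Ji≡ | inj₁ Je≡ =
    s≤s⁻¹ (hook (suc i) (suc e) j m (s≤s i≤e) (subst (j <_) Je≡ j<Je)
      (≤-trans (successor-≥ r J suc-J (suc e)) Je≤j)
      (trans (+-suc _ _) (trans (cong suc (trans (cong (_+ suc e) (sym Ji≡)) eq)) (sym (+-suc _ _)))))
  ... | inj₁ Ji≡ | inj₂ (p , K , pa≡ , min , refl) = ≰⇒> contra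
    where
    -- With a leg of at least `m * a`, row `q * a` for `q = p - m` would lie strictly below `i` but
    -- not below `e`. Then `K ≤ level r q` makes the arm at least `m * d`, and a hook of length
    -- `m * b` leaves a leg shorter than `m * a`.
    contra : ¬ (i + m * a ≤ e)
    contra le = absurd m refl (p ∸ m) (m∸n+n≡m (<⇒≤ m<p))
      where
      m<p : m < p
      m<p = *-cancelʳ-< a m p (subst (m * a <_) (sym pa≡) (s≤s (≤-trans (m≤n+m _ i) le)))
      absurd : ∀ m′ → m′ ≡ m → ∀ q → q + m ≡ p → ⊥
      -- A hook has positive length; a positive `m` is needed below to place row `q * a` within the
      -- range of the minimum `K`.
      absurd zero     refl q _    = <⇒≢ (+-mono-≤ (≤-trans j<Je (anti-≤ J anti-J i≤e)) (s≤s i≤e))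
        (trans (+-suc j i) (trans (+-comm (suc j) i) (sym eq)))
      absurd (suc m′) refl q refl =
        <⇒≱ (count i e j (suc m′) q a d (r (suc i)) (r (q * a)) (J e)
            (anti-≤ r anti-r i<qa) (proj₁ min q (s≤s⁻¹ qa<1+e)) j<Je
            (trans (cong (_+ suc e) (sym Ji≡)) eq)) le
        where
        qa<1+e : q * a < suc e
        qa<1+e = subst (q * a <_) (trans (sym (*-distribʳ-+ a q (suc m′))) pa≡) (m<m+n (q * a) (s≤s z≤n))
        i<qa : suc i ≤ q * a
        i<qa = +-cancelʳ-≤ (suc m′ * a) _ _ (≤-trans (s≤s le) (≤-reflexive (trans (sym pa≡) (*-distribʳ-+ a q (suc m′)))))
        count : ∀ i e j m q a d x y z → y ≤ x → z + (q + m) * d ≤ y + q * d → suc j ≤ z →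
          x + suc e ≡ m * (a + d) + (i + suc j) → suc e ≤ i + m * a
        count i e j m q a d x y z h₁ h₂ h₃ h₄ =
          lin (h₁ ⊕ h₂ ⊕ h₃ ⊕ ≤-reflexive h₄) (solve (i ∷ e ∷ j ∷ m ∷ q ∷ a ∷ d ∷ x ∷ y ∷ z ∷ []))
  ... | inj₂ (p , K , pa≡ , (_ , g , ga≤i , K≡) , JK) | inj₁ Je≡ =
    conclude (p ∸ g) (m∸n+n≡m (<⇒≤ g<p))
    where
    g<p : g < p
    g<p = *-cancelʳ-< a g p (subst (g * a <_) (sym pa≡) (s≤s ga≤i))
    conclude : ∀ n → n + g ≡ p → e < i + m * a
    -- Moving the top to the row `g * a` of `r` that attains `K` lengthens the hook by exactly
    -- `n * b`; the extra `n * a` in the bound is absorbed by `(n + g) * a ≡ suc i`.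
    conclude n refl = finish i e m n g a pa≡
      (hook (g * a) (suc e) j (m + n) (≤-trans ga≤i (m≤n⇒m≤1+n i≤e)) (subst (j <_) Je≡ j<Je)
        (≤-trans (successor-≥ r J suc-J (suc e)) Je≤j)
        (total i e j m n g a d (r (g * a)) (J i) pa≡ (trans JK K≡) eq))
      where
      total : ∀ i e j m n g a d x z → (n + g) * a ≡ suc i → z + (n + g) * d ≡ x + g * d →
        z + suc e ≡ m * (a + d) + (i + suc j) → x + suc (suc e) ≡ (m + n) * (a + d) + (g * a + suc j)
      total i e j m n g a d x z h₁ h₂ h₃ =
        eqlin (cong₂ _+_ (cong₂ _+_ (sym h₁) (sym h₂)) h₃) (solve (i ∷ e ∷ j ∷ m ∷ n ∷ g ∷ a ∷ d ∷ x ∷ z ∷ []))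
      finish : ∀ i e m n g a → (n + g) * a ≡ suc i → suc (suc e) ≤ g * a + (m + n) * a → suc e ≤ i + m * a
      finish i e m n g a h₁ h₂ = lin (≤-reflexive h₁ ⊕ h₂) (solve (i ∷ e ∷ m ∷ n ∷ g ∷ a ∷ []))
  ... | inj₂ (p , K , pa≡ , min , JK) | inj₂ (p′ , K′ , pa≡′ , min′ , JK′) =
    -- Since `K′ ≤ K`, the two jump equations turn the hook length into `p′ * b < (p + m) * b`;
    -- cancelling `b` and multiplying by `a` gives the leg bound.
    s≤s⁻¹ (subst₂ _≤_ (cong suc pa≡′) bound (*-monoˡ-< a p′<p+m))
    where
    bound : (p + m) * a ≡ suc (i + m * a)
    bound = trans (*-distribʳ-+ a p m) (cong (_+ m * a) pa≡)
    count : ∀ i e j m p p′ a d z z′ K K′ → p * a ≡ suc i → p′ * a ≡ suc e → z + p * d ≡ K → z′ + p′ * d ≡ K′ →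
      K′ ≤ K → suc j ≤ z′ → z + suc e ≡ m * (a + d) + (i + suc j) → suc (p′ * (a + d)) ≤ (p + m) * (a + d)
    count i e j m p p′ a d z z′ K K′ h₁ h₂ h₃ h₄ h₅ h₆ h₇ =
      lin (≤-reflexive (sym h₁) ⊕ ≤-reflexive h₂ ⊕ ≤-reflexive (sym h₃) ⊕ ≤-reflexive h₄ ⊕ h₅ ⊕ h₆ ⊕ ≤-reflexive h₇)
        (solve (i ∷ e ∷ j ∷ m ∷ p ∷ p′ ∷ a ∷ d ∷ z ∷ z′ ∷ K ∷ K′ ∷ []))
    p′<p+m : p′ < p + m
    p′<p+m = *-cancelʳ-< b p′ (p + m)
      (count i e j m p p′ a d (J i) (J e) K K′ pa≡ pa≡′ JK JK′ (min-anti r i≤e min min′) j<Je eq)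

  -- Passing to the successor removes row 0 of the regularization.

  prefixMin : (ℕ → ℕ) → ℕ → ℕ
  prefixMin r zero    = level r 0
  prefixMin r (suc t) = prefixMin r t ⊓ level r (suc t)

  prefixMin-≤ : ∀ r t q → q ≤ t → prefixMin r t ≤ level r q
  prefixMin-≤ r zero    zero _ = ≤-refl
  prefixMin-≤ r (suc t) q q≤1+t with m≤n⇒m<n∨m≡n q≤1+t
  ... | inj₁ q<1+t = ≤-trans (m⊓n≤m _ _) (prefixMin-≤ r t q (s≤s⁻¹ q<1+t))
  ... | inj₂ refl  = m⊓n≤n (prefixMin r t) _

  prefixMin-attained : ∀ r t → ∃ λ g → g ≤ t × prefixMin r t ≡ level r g
  prefixMin-attained r zero    = 0 , z≤n , refl
  prefixMin-attained r (suc t) with ⊓-sel (prefixMin r t) (level r (suc t)) | prefixMin-attained r t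
  ... | inj₁ eq | g , g≤t , eq′ = g , m≤n⇒m≤1+n g≤t , trans eq eq′
  ... | inj₂ eq | _             = suc t , ≤-refl , eq

  prefixMin-isMin : ∀ r t {i} → t * a ≤ i → i < suc t * a → IsMin r i (prefixMin r t)
  prefixMin-isMin r t ta≤i i<1+ta
    = (λ q qa≤i → prefixMin-≤ r t q (s≤s⁻¹ (*-cancelʳ-< a q (suc t) (≤-<-trans qa≤i i<1+ta))))
    , (let g , g≤t , eq = prefixMin-attained r t in g , ≤-trans (*-monoˡ-≤ a g≤t) ta≤i , eq)

  not-multiple : ∀ p t {x} → 0 < x → x < a → p * a ≢ x + t * a
  not-multiple p t {x} 0<x x<a eq with p ≤? t
  ... | yes p≤t = <⇒≢ (≤-<-trans (*-monoˡ-≤ a p≤t) (m<n+m (t * a) 0<x)) eq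
  ... | no  p≰t = <⇒≢ (<-≤-trans (+-monoˡ-< (t * a) x<a) (*-monoˡ-≤ a (≰⇒> p≰t))) (sym eq)

  successor-shift : ∀ r J → Successor r J → ∀ i t → suc i < a → J (i + t * a) ≡ r (suc i + t * a)
  successor-shift r J suc-J i t i<a with shift-or-jump r J suc-J (i + t * a)
  ... | inj₁ eq               = eq
  ... | inj₂ (p , _ , eq , _) = ⊥-elim (not-multiple p t (s≤s z≤n) i<a eq)

  -- The equation makes `z + d` the larger of `x` and `w`, so both sides count the same two numbers
  -- against the threshold `Y + d`.
  ind-exchange : ∀ x w z Y → z + d + (w ⊓ x) ≡ x + w →
    ind x (Y + d) + ind w (Y + d) ≡ ind z Y + ind (w ⊓ x) (Y + d)
  ind-exchange x w z Y eq with ≤-total w x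
  ... | inj₁ w≤x rewrite m≤n⇒m⊓n≡m w≤x | sym (+-cancelʳ-≡ w (z + d) x eq) =
    cong (_+ ind w (Y + d)) (ind-cong {z + d} {Y + d} {z} {Y} (+-cancelʳ-≤ d z Y) (+-monoˡ-≤ d))
  ... | inj₂ x≤w rewrite m≥n⇒m⊓n≡n x≤w | sym (+-cancelʳ-≡ x (z + d) w (trans eq (+-comm x w))) =
    trans (+-comm (ind x (Y + d)) _)
      (cong (_+ ind x (Y + d)) (ind-cong {z + d} {Y + d} {z} {Y} (+-cancelʳ-≤ d z Y) (+-monoˡ-≤ d)))

  -- The successor acts on these levels like one pass of bubble sort: the running minimum is carried
  -- on, and the larger of it and the next level is left behind. The indicator sums telescope,
  -- leaving only the last minimum.
  deficit-successor : ∀ r J → Successor r J → ∀ Y →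
    deficit r 0 (Y + d) ≡ deficit J a′ Y + ind (prefixMin r (Y + d)) (Y + d)
  deficit-successor r J suc-J Y = begin
    deficit r 0 Z
      ≡⟨ +-comm (ind (level r 0) Z) _ ⟩
    sumTo Z (λ t → ind (level r (suc t)) Z) + ind (prefixMin r 0) Z
      ≡⟨ sumTo-telescope Z {λ t → ind (level r (suc t)) Z} {gap J a′ Y} {λ t → ind (prefixMin r t) Z} exchange ⟩
    sumTo Z (gap J a′ Y) + ind (prefixMin r Z) Z
      ≡⟨ cong (_+ ind (prefixMin r Z) Z) (deficit-tail J a′ Z (<-≤-trans (m<m+n Y (s≤s z≤n)) (m≤m*d Z))) ⟩
    deficit J a′ Y + ind (prefixMin r Z) Z ∎
    where
    open ≡-Reasoning
    Z = Y + d
    arrange : ∀ j k x w t d → j + k ≡ x + w → j + t * d + d + k ≡ x + suc t * d + w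
    arrange j k x w t d e = eqlin e (solve (j ∷ k ∷ x ∷ w ∷ t ∷ d ∷ []))
    exchange : ∀ t → ind (level r (suc t)) Z + ind (prefixMin r t) Z ≡ gap J a′ Y t + ind (prefixMin r (suc t)) Z
    exchange t with suc-J (a′ + t * a)
    ... | K , K′ , min , min′ , eq
      with min-unique r min (prefixMin-isMin r t (m≤n+m _ a′) ≤-refl)
         | min-unique r min′ (prefixMin-isMin r (suc t) ≤-refl (m<n+m _ (s≤s z≤n)))
    ... | refl | refl = ind-exchange (level r (suc t)) (prefixMin r t) (J (a′ + t * a) + t * d) Y
      (arrange (J (a′ + t * a)) (prefixMin r (suc t)) (r (suc t * a)) (prefixMin r t) t d eq)

  -- Ladders starting in a row above `a′` come from ladders of `r` one row lower. The ladder of `J`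
  -- from row `a′` corresponds to one of `r` from row 0, where the index rises from `u` to `suc u`.
  -- The minimum accounts for at most one further missing box; if for none, the ladder of `r` is
  -- full.
  regularizes-successor : ∀ r J s → Successor r J → Regularizes r s → Regularizes J (s ∘ suc)
  regularizes-successor r J s suc-J reg i u y i<a with m≤n⇒m<n∨m≡n i<a
  ... | inj₁ 1+i<a = subst
      (λ D → (D ≤ u → y < s (suc i + u * a)) × (y < s (suc i + u * a) → D ≤ u))
      (sumTo-cong (suc (y + u * d)) (λ t → cong (λ x → ind (x + t * d) (y + u * d)) (sym (successor-shift r J suc-J i t 1+i<a))))
      (reg (suc i) u y 1+i<a)
  ... | inj₂ refl = (λ D≤u → proj₁ top (to D≤u)) , (λ inside → from (proj₂ top inside))
    where
    Y = y + u * d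
    shift : ∀ y u d → y + suc u * d ≡ y + u * d + d
    shift y u d = solve (y ∷ u ∷ d ∷ [])
    top : (deficit r 0 (Y + d) ≤ suc u → y < s (suc u * a)) × (y < s (suc u * a) → deficit r 0 (Y + d) ≤ suc u)
    top = subst (λ Z → (deficit r 0 Z ≤ suc u → y < s (suc u * a)) × (y < s (suc u * a) → deficit r 0 Z ≤ suc u))
      (shift y u d) (reg 0 (suc u) y (s≤s z≤n))
    split = deficit-successor r J suc-J Y
    to : deficit J a′ Y ≤ u → deficit r 0 (Y + d) ≤ suc u
    to h = ≤-trans (≤-reflexive split) (≤-trans (+-mono-≤ h (ind≤1 (prefixMin r (Y + d)) (Y + d))) (≤-reflexive (+-comm u 1)))
    from : deficit r 0 (Y + d) ≤ suc u → deficit J a′ Y ≤ u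
    from h with prefixMin r (Y + d) ≤? Y + d
    ... | yes low = s≤s⁻¹ (≤-trans (≤-reflexive (trans (+-comm 1 _) (trans (cong (deficit J a′ Y +_) (sym (ind-yes low))) (sym split)))) h)
    ... | no  ¬low = ≤-trans (m≤m+n (deficit J a′ Y) _) (≤-trans (≤-reflexive (trans (sym split) full)) z≤n)
      where
      full : deficit r 0 (Y + d) ≡ 0
      full with deficit r 0 (Y + d) in eq
      ... | zero  = refl
      ... | suc _ with sumTo-< (suc (Y + d)) {λ _ → 0} {gap r 0 (Y + d)}
                    (≤-trans (s≤s (≤-reflexive (sumTo-zero (suc (Y + d)) (λ _ → refl)))) (≤-trans (s≤s z≤n) (≤-reflexive (sym eq))))
      ...   | t , 0<gap with level r t ≤? Y + d
      ...     | no  h′ = ⊥-elim (<⇒≢ 0<gap (sym (ind-no (≰⇒> h′))))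
      -- A level of at most `Y + d` has an index of at most `Y + d`, so the prefix minimum covers
      -- it.
      ...     | yes h′ = ⊥-elim (¬low (≤-trans (prefixMin-≤ r (Y + d) t (≤-trans (m≤m*d t) (≤-trans (m≤n+m _ _) h′))) h′))

  -- The invariant along the pieces of the b-rim.

  -- State on entering row i: P pieces of the b-rim have been completed and the current
  -- one started in a row s with K + s = r s + P b.
  Invariant : (ℕ → ℕ) → ℕ → ℕ → ℕ → Set
  Invariant r i P K = (∀ q → q ≤ P ⊎ q * a ≤ i → K ≤ level r q)
    × (∃ λ g → g ≤ P × g * a ≤ i × K ≡ level r g)

  invariant⇒min : ∀ r {i P K} → Invariant r i P K → IsMin r i K
  invariant⇒min r (low , g , _ , ga≤i , eq) = (λ q → low q ∘ inj₂) , g , ga≤i , eq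

  invariant-start : ∀ r → Invariant r 0 0 (r 0)
  invariant-start r = low , 0 , z≤n , z≤n , sym (+-identityʳ _)
    where
    low : ∀ q → q ≤ 0 ⊎ q * a ≤ 0 → r 0 ≤ level r q
    low zero    _         = ≤-reflexive (sym (+-identityʳ _))
    low (suc q) (inj₁ ())
    low (suc q) (inj₂ ())

  -- The only new level has `q * a ≡ suc i` and `q > P`. The unfinished piece gives
  -- `K + q * a ≤ suc P * b + r (q * a)`, and `suc P * b ≤ q * b`.
  invariant-continue : ∀ r {i P K} → Invariant r i P K →
    suc (K + suc i) ≤ suc P * b + suc (r (suc i)) → Invariant r (suc i) P K
  invariant-continue r {i} {P} {K} (low , g , g≤P , ga≤i , eq) short =
    low′ , g , g≤P , m≤n⇒m≤1+n ga≤i , eq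
    where
    count : ∀ K q P a d x → suc (K + q * a) ≤ suc P * (a + d) + suc x → suc P * (a + d) ≤ q * (a + d) → K ≤ x + q * d
    count K q P a d x h₁ h₂ = lin (h₁ ⊕ h₂) (solve (K ∷ q ∷ P ∷ a ∷ d ∷ x ∷ []))
    low′ : ∀ q → q ≤ P ⊎ q * a ≤ suc i → K ≤ level r q
    low′ q (inj₁ q≤P) = low q (inj₁ q≤P)
    low′ q (inj₂ qa≤1+i) with q ≤? P | m≤n⇒m<n∨m≡n qa≤1+i
    ... | yes q≤P | _         = low q (inj₁ q≤P)
    ... | no  _   | inj₁ qa≤i = low q (inj₂ (s≤s⁻¹ qa≤i))
    ... | no  q≰P | inj₂ qa≡  = count K q P a d (r (q * a))
      (subst (λ n → suc (K + n) ≤ suc P * b + suc (r n)) (sym qa≡) short) (*-monoˡ-≤ b (≰⇒> q≰P))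

  -- Let `g` attain `K`. Column `J - 1` ends in row `i`, and its box in row `g * a` has hook length
  -- `(suc P - g) * b`, to which the hook bound applies.
  piece-rows-≤ : ∀ r {i P K} J → HookCond r → Invariant r i P K →
    J + suc P * b ≡ K + suc i → r (suc i) < J → J ≤ r i → suc i ≤ suc P * a
  piece-rows-≤ r {i} {P} {K} (suc j) hook (low , g , g≤P , ga≤i , eq) end r<J J≤r =
    go (suc P ∸ g) (m∸n+n≡m (m≤n⇒m≤1+n g≤P))
    where
    go : ∀ m → m + g ≡ suc P → suc i ≤ suc P * a
    go m eq′ = ≤-trans (hook (g * a) i j m ga≤i J≤r (s≤s⁻¹ r<J)
        (total i j m g a d (r (g * a)) K (suc P) eq′ eq end))
      (≤-reflexive (trans (+-comm (g * a) (m * a)) (trans (sym (*-distribʳ-+ a m g)) (cong (_* a) eq′))))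
      where
      total : ∀ i j m g a d x K p → m + g ≡ p → K ≡ x + g * d → suc j + p * (a + d) ≡ K + suc i →
        x + suc i ≡ m * (a + d) + (g * a + suc j)
      total i j m g a d x K .(m + g) refl e₁ e₂ =
        eqlin (cong₂ _+_ (sym e₁) (sym e₂)) (solve (i ∷ j ∷ m ∷ g ∷ a ∷ d ∷ x ∷ K ∷ []))

  -- Otherwise `level r (suc P) < K′`, and `Cornered` at `K′ - 1` yields a column ending just above
  -- row `suc v * a`. The invariant forces `suc v > P` and `suc v * a > i`. Unless that row is
  -- `suc i` itself, the box of this column in row `suc i` has hook length `(v - P) * b`, and its
  -- bound gives the claim.
  piece-rows-≥ : ∀ r {i P K K′} → Anti r → HookCond r → Cornered r → Invariant r i P K →
    K′ + suc i ≡ r (suc i) + suc P * b → K′ ≤ K → suc P * a ≤ suc i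
  piece-rows-≥ r {i} {P} {K} {K′} anti hook corner (low , _) next K′≤K = ≮⇒≥ λ short → absurd short K′ refl
    where
    below : ∀ x y p a d i K → x ≤ y → suc (suc i) ≤ p * a → K + suc i ≡ y + p * (a + d) → suc (x + p * d) ≤ K
    below x y p a d i K h₁ h₂ h₃ = lin (h₁ ⊕ h₂ ⊕ ≤-reflexive (sym h₃)) (solve (x ∷ y ∷ p ∷ a ∷ d ∷ i ∷ K ∷ []))
    absurd : suc i < suc P * a → ∀ k → k ≡ K′ → ⊥
    -- This shows that `K′` is positive, so that it can be written `suc Y`.
    absurd short k refl with ≤-trans (s≤s z≤n) (below (r (suc P * a)) (r (suc i)) (suc P) a d i k (anti-≤ r anti (<⇒≤ short)) short next)
    absurd short (suc Y) refl | _ with corner Y (suc P)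
        (≤-trans K′≤K (≤-trans (low 0 (inj₁ z≤n)) (≤-reflexive (+-identityʳ _))))
        (s≤s⁻¹ (below (r (suc P * a)) (r (suc i)) (suc P) a d i (suc Y) (anti-≤ r anti (<⇒≤ short)) short next))
    ... | v , under , over = <⇒≱ short (long (m≤n⇒m<n∨m≡n i<va))
      where
      ¬low : ¬ (suc v ≤ P ⊎ suc v * a ≤ i)
      ¬low h = <⇒≱ (s≤s under) (≤-trans K′≤K (low (suc v) h))
      P<v : suc P ≤ suc v
      P<v = ≰⇒> (¬low ∘ inj₁)
      i<va : suc i ≤ suc v * a
      i<va = ≰⇒> (¬low ∘ inj₂)
      column : ∃ λ j → j + suc v * d ≡ Y
      column = Y ∸ suc v * d , m∸n+n≡m (≤-trans (m≤n+m _ (r (suc v * a))) under)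
      total : ∀ x i j p v n a d → n + p ≡ v → suc (j + v * d) + suc i ≡ x + p * (a + d) →
        x + v * a ≡ n * (a + d) + (suc i + suc j)
      total x i j p .(n + p) n a d refl e = eqlin (sym e) (solve (x ∷ i ∷ j ∷ p ∷ n ∷ a ∷ d ∷ []))
      finish : ∀ v p n a i → n + p ≡ v → v * a ≤ i + n * a → p * a ≤ i
      finish .(n + p) p n a i refl h = lin h (solve (p ∷ n ∷ a ∷ i ∷ []))
      long : suc i < suc v * a ⊎ suc i ≡ suc v * a → suc P * a ≤ suc i
      long (inj₂ eq) = subst (suc P * a ≤_) (sym eq) (*-monoˡ-≤ a P<v)
      long (inj₁ lt) with column
      ... | j , refl = finish (suc v) (suc P) (suc v ∸ suc P) a (suc i) split
          (hook (suc i) (a′ + v * a) j (suc v ∸ suc P) (s≤s⁻¹ lt)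
            (+-cancelʳ-< (suc v * d) _ _ over)
            (+-cancelʳ-≤ (suc v * d) _ _ under)
            (total (r (suc i)) i j (suc P) (suc v) (suc v ∸ suc P) a d split next))
        where
        split : suc v ∸ suc P + suc P ≡ suc v
        split = m∸n+n≡m P<v

  -- The start of the next piece in row `suc i` determines `K′`. If `J ≡ r (suc i)`, the minimum
  -- stays; otherwise the two row bounds meet in `suc i ≡ suc P * a`, and `K′` is the level of
  -- `suc P`.
  invariant-end : ∀ r {i P K} J → Anti r → HookCond r → Cornered r → Invariant r i P K →
    J + suc P * b ≡ K + suc i → r (suc i) ≤ J → J ≤ r i →
    ∃ λ K′ → Invariant r (suc i) (suc P) K′ × J + K′ ≡ r (suc i) + K
  invariant-end r {i} {P} {K} J anti hook corner inv@(low , g , g≤P , ga≤i , eq) end r≤J J≤r =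
    K′ , (low′ , attained) , exchange J K K′ (suc i) (r (suc i)) (suc P * b) end next
    where
    jump : r (suc i) < J → suc i ≤ suc P * a
    jump r<J = piece-rows-≤ r J hook inv end r<J J≤r
    -- Keeps the subtraction in `K′` from truncating.
    room : suc i ≤ r (suc i) + suc P * b
    room with m≤n⇒m<n∨m≡n r≤J
    ... | inj₁ r<J = ≤-trans (jump r<J) (≤-trans (*-monoʳ-≤ (suc P) (m≤m+n a d)) (m≤n+m _ _))
    ... | inj₂ r≡J = ≤-trans (m≤n+m (suc i) K) (≤-reflexive (trans (sym end) (cong (_+ suc P * b) (sym r≡J))))
    K′ = r (suc i) + suc P * b ∸ suc i
    next : K′ + suc i ≡ r (suc i) + suc P * b
    next = m∸n+n≡m room
    K′≤K : K′ ≤ K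
    K′≤K = +-cancelʳ-≤ (suc i) _ _ (≤-trans (≤-reflexive next) (≤-trans (+-monoˡ-≤ _ r≤J) (≤-reflexive end)))
    long : suc P * a ≤ suc i
    long = piece-rows-≥ r anti hook corner inv next K′≤K
    exchange : ∀ J K K′ i x p → J + p ≡ K + i → K′ + i ≡ x + p → J + K′ ≡ x + K
    exchange J K K′ i x p e₁ e₂ = eqlin (cong₂ _+_ e₁ e₂) (solve (J ∷ K ∷ K′ ∷ i ∷ x ∷ p ∷ []))
    new : ∀ K i x y p q a d → K + i ≡ x + p * (a + d) → x ≤ y → q * a ≤ i → p * d ≤ q * d → p * a ≤ q * a → K ≤ y + q * d
    new K i x y p q a d h₁ h₂ h₃ h₄ h₅ =
      lin (≤-reflexive h₁ ⊕ h₂ ⊕ h₃ ⊕ h₄ ⊕ h₅) (solve (K ∷ i ∷ x ∷ y ∷ p ∷ q ∷ a ∷ d ∷ []))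
    low′ : ∀ q → q ≤ suc P ⊎ q * a ≤ suc i → K′ ≤ level r q
    low′ q h with q ≤? P | q * a ≤? suc i
    ... | yes q≤P | _      = ≤-trans K′≤K (low q (inj₁ q≤P))
    ... | no  q≰P | yes qa≤ = new K′ (suc i) (r (suc i)) (r (q * a)) (suc P) q a d next (anti-≤ r anti qa≤) qa≤
                                (*-monoˡ-≤ d (≰⇒> q≰P)) (*-monoˡ-≤ a (≰⇒> q≰P))
    low′ q (inj₁ q≤1+P) | no _ | no qa≰ = ⊥-elim (qa≰ (≤-trans (*-monoˡ-≤ a q≤1+P) long))
    low′ q (inj₂ qa≤)   | no _ | no qa≰ = ⊥-elim (qa≰ qa≤)
    cancel : ∀ K x p a d → K + p * a ≡ x + p * (a + d) → K ≡ x + p * d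
    cancel K x p a d e = eqlin e (solve (K ∷ x ∷ p ∷ a ∷ d ∷ []))
    attained : ∃ λ g → g ≤ suc P × g * a ≤ suc i × K′ ≡ level r g
    attained with m≤n⇒m<n∨m≡n r≤J
    ... | inj₂ r≡J = g , m≤n⇒m≤1+n g≤P , m≤n⇒m≤1+n ga≤i ,
          trans (+-cancelʳ-≡ (suc i) _ _ (trans next (trans (cong (_+ suc P * b) r≡J) end))) eq
    ... | inj₁ r<J = suc P , ≤-refl , long ,
          cancel K′ (r (suc P * a)) (suc P) a d (subst (λ n → K′ + n ≡ r n + suc P * b) (≤-antisym (jump r<J) long) next)

  -- From a level below `K`, `Cornered` produces an index `suc v` whose level is also below `K`.
  -- Either its row is at most `k`, against the invariant, or the row just above it is already empty
  -- and cannot contain the corner.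
  invariant-final : ∀ r {k P K} → Cornered r → (∀ i → k ≤ i → r i ≡ 0) → Invariant r k P K →
    ∀ q → K ≤ level r q
  invariant-final r {k} {P} {zero}  corner vanish inv q = z≤n
  invariant-final r {k} {P} {suc Y} corner vanish (low , _) q = ≮⇒≥ λ lt → absurd (s≤s⁻¹ lt)
    where
    absurd : level r q ≤ Y → ⊥
    absurd h with corner Y q (≤-trans (low 0 (inj₁ z≤n)) (≤-reflexive (+-identityʳ _))) h
    ... | v , under , over with suc v * a ≤? k
    ...   | yes va≤k = <⇒≱ (s≤s under) (low (suc v) (inj₂ va≤k))
    ...   | no  va≰k = <⇒≱ over (subst (λ x → x + suc v * d ≤ Y) (sym (vanish _ (s≤s⁻¹ (≰⇒> va≰k)))) (≤-trans (m≤n+m _ _) under))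

  -- The size of the b-rim modulo `b`.

  -- δ records whether the last piece of the rim is complete; t is what it lacks.
  Residue : ℕ → ℕ → ℕ → ℕ → Set
  Residue δ rem s s′
    = (δ ≡ 1 × ∃ λ n → s ≡ s′ + (rem + n * b))
    ⊎ (δ ≡ 0 × ∃ λ n → ∃ λ t → 0 < t × t < b × s + t ≡ s′ + (rem + n * b))

  RimResidue : ℕ → ℕ → List ℕ → Set
  RimResidue δ rem xs = Residue δ rem (sum xs) (sum (removeRim b rem xs))

  residue-end : ∀ {δ rem z s} y → Residue δ b z s → Residue δ rem (y + rem + z) (y + s)
  residue-end {rem = rem} {z} {s} y (inj₁ (eq , n , e)) = inj₁ (eq , suc n , arrange y rem s z n b e)
    where
    arrange : ∀ y rem s z n b → z ≡ s + (b + n * b) → y + rem + z ≡ y + s + (rem + suc n * b)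
    arrange y rem s z n b e = eqlin e (solve (y ∷ rem ∷ s ∷ z ∷ n ∷ b ∷ []))
  residue-end {rem = rem} {z} {s} y (inj₂ (eq , n , t , 0<t , t<b , e)) =
    inj₂ (eq , suc n , t , 0<t , t<b , arrange y rem s z n b t e)
    where
    arrange : ∀ y rem s z n b t → z + t ≡ s + (b + n * b) → y + rem + z + t ≡ y + s + (rem + suc n * b)
    arrange y rem s z n b t e = eqlin e (solve (y ∷ rem ∷ s ∷ z ∷ n ∷ b ∷ t ∷ []))

  residue-continue : ∀ {δ rem z s} y c → Residue δ rem z s → Residue δ (rem + c) (y + c + z) (y + s)
  residue-continue {rem = rem} {z} {s} y c (inj₁ (eq , n , e)) = inj₁ (eq , n , arrange y c rem s z (n * b) e)
    where
    arrange : ∀ y c rem s z k → z ≡ s + (rem + k) → y + c + z ≡ y + s + (rem + c + k)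
    arrange y c rem s z k e = eqlin e (solve (y ∷ c ∷ rem ∷ s ∷ z ∷ k ∷ []))
  residue-continue {rem = rem} {z} {s} y c (inj₂ (eq , n , t , 0<t , t<b , e)) =
    inj₂ (eq , n , t , 0<t , t<b , arrange y c rem s z (n * b) t e)
    where
    arrange : ∀ y c rem s z k t → z + t ≡ s + (rem + k) → y + c + z + t ≡ y + s + (rem + c + k)
    arrange y c rem s z k t e = eqlin e (solve (y ∷ c ∷ rem ∷ s ∷ z ∷ k ∷ t ∷ []))

  rim-residue-end : ∀ δ rem x xs → rem ≤ x → rem ≤ suc x ∸ (1 ⊔ head0 xs) →
    RimResidue δ b xs → RimResidue δ rem (x ∷ xs)
  rim-residue-end δ rem x xs rem≤x h res =
    subst₂ (Residue δ rem) (cong (_+ sum xs) (m∸n+n≡m rem≤x)) (cong sum (sym (removeRim-end b rem x xs h)))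
      (residue-end (x ∸ rem) res)

  rim-residue-continue : ∀ δ rem x xs c → suc x ∸ (1 ⊔ head0 xs) ≡ c → c ≤ x → c < rem →
    RimResidue δ (rem ∸ c) xs → RimResidue δ rem (x ∷ xs)
  rim-residue-continue δ rem x xs c refl c≤x h res = subst (λ w → Residue δ w (x + sum xs) (sum (removeRim b rem (x ∷ xs))))
    (m∸n+n≡m (<⇒≤ h))
    (subst₂ (Residue δ (rem ∸ c + c)) (cong (_+ sum xs) (m∸n+n≡m c≤x)) (cong sum (sym (removeRim-continue b rem x xs h)))
      (residue-continue (x ∸ c) c res))

  -- Traversing the rows along the b-rim.

  Global : (ℕ → ℕ) → ℕ → Set
  Global r K = (∀ q → K ≤ level r q) × (∃ λ g → K ≡ level r g)

  module _ (r : ℕ → ℕ) (anti : Anti r) (hook : HookCond r) (corner : Cornered r) where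

    GoodRow : ℕ → ℕ → Set
    GoodRow i y = SuccessorRow r i y × y ≤ r i

    -- The last equation telescopes `y + K′ ≡ r (suc i) + K` over the remaining rows. At the top `K`
    -- is the first row, so there it makes the global minimum the size drop of J_b.
    Outcome : ℕ → ℕ → ℕ → ℕ → List ℕ → Set
    Outcome i K rem x xs = ∃ λ δ → ∃ λ Kf → RimResidue δ rem (x ∷ xs) × Global r Kf
      × (∀ t → GoodRow (i + t) (row (bump δ (removeRim b rem (x ∷ xs))) t))
      × sum xs + K ≡ sum (bump δ (removeRim b rem (x ∷ xs))) + Kf

    good-last : ∀ {i P P′ K K′} y → y ≤ r i → (∀ j → suc i ≤ j → r j ≡ 0) →
      Invariant r i P K → Invariant r (suc i) P′ K′ → y + K′ ≡ r (suc i) + K →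
      Global r K′ × (∀ t → GoodRow (i + t) (row (y ∷ []) t)) × K ≡ y + 0 + K′
    good-last {i} {P} {P′} {K} {K′} y y≤r vanish inv inv′ eq = (final , g , eqg) , good ,
      trans (sym (trans eq (cong (_+ K) (vanish (suc i) ≤-refl)))) (cong (_+ K′) (sym (+-identityʳ y)))
      where
      final = invariant-final r corner vanish inv′
      g = proj₁ (proj₂ inv′)
      ga≤ : g * a ≤ suc i
      ga≤ = proj₁ (proj₂ (proj₂ (proj₂ inv′)))
      eqg : K′ ≡ level r g
      eqg = proj₂ (proj₂ (proj₂ (proj₂ inv′)))
      min : ∀ {j} → suc i ≤ j → IsMin r j K′
      min le = (λ q _ → final q) , g , ≤-trans ga≤ le , eqg
      good : ∀ t → GoodRow (i + t) (row (y ∷ []) t)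
      good zero    rewrite +-identityʳ i = (K , K′ , invariant⇒min r inv , invariant⇒min r inv′ , eq) , y≤r
      good (suc t) rewrite +-suc i t =
        (K′ , K′ , min (s≤s (m≤m+n i t)) , min (m≤n⇒m≤1+n (s≤s (m≤m+n i t))) ,
          cong (_+ K′) (sym (vanish _ (m≤n⇒m≤1+n (s≤s (m≤m+n i t)))))) , z≤n

    good-cons : ∀ {i P P′ K K′ y ys} → y ≤ r i →
      Invariant r i P K → Invariant r (suc i) P′ K′ → y + K′ ≡ r (suc i) + K →
      (∀ t → GoodRow (suc i + t) (row ys t)) → ∀ t → GoodRow (i + t) (row (y ∷ ys) t)
    good-cons {i} y≤r inv inv′ eq good zero rewrite +-identityʳ i =
      (_ , _ , invariant⇒min r inv , invariant⇒min r inv′ , eq) , y≤r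
    good-cons {i} y≤r inv inv′ eq good (suc t) rewrite +-suc i t = good t

    outcome-cons : ∀ {i P P′ K K′ rem rem′ δ} m x x₁ xs → suc m ≤ r i → x₁ ≡ r (suc i) →
      Invariant r i P K → Invariant r (suc i) P′ K′ → suc m + K′ ≡ r (suc i) + K →
      removeRim b rem (x ∷ x₁ ∷ xs) ≡ m ∷ removeRim b rem′ (x₁ ∷ xs) →
      RimResidue δ rem (x ∷ x₁ ∷ xs) →
      (∃ λ Kf → Global r Kf
        × (∀ t → GoodRow (suc i + t) (row (bump δ (removeRim b rem′ (x₁ ∷ xs))) t))
        × sum xs + K′ ≡ sum (bump δ (removeRim b rem′ (x₁ ∷ xs))) + Kf) →
      Outcome i K rem x (x₁ ∷ xs)
    outcome-cons {i} {K = K} {K′} {rem} {rem′} {δ} m x x₁ xs m<r x₁≡ inv inv′ eq cut res (Kf , glob , good , total) =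
      δ , Kf , res , glob ,
      (λ t → subst (λ zs → GoodRow (i + t) (row zs t)) (sym shape) (good-cons m<r inv inv′ eq good t)) ,
      subst (λ zs → x₁ + sum xs + K ≡ sum zs + Kf) (sym shape)
        (arrange (suc m) x₁ (sum xs) K K′ _ Kf (trans eq (cong (_+ K) (sym x₁≡))) total)
      where
      shape : bump δ (removeRim b rem (x ∷ x₁ ∷ xs)) ≡ suc m ∷ bump δ (removeRim b rem′ (x₁ ∷ xs))
      shape = trans (cong (bump δ) cut) (bump-removeRim δ m b rem′ x₁ xs)
      arrange : ∀ m x s K K′ s′ Kf → m + K′ ≡ x + K → s + K′ ≡ s′ + Kf → x + s + K ≡ m + s′ + Kf
      arrange m x s K K′ s′ Kf e₁ e₂ = eqlin (cong₂ _+_ (sym e₁) e₂) (solve (m ∷ x ∷ s ∷ K ∷ K′ ∷ s′ ∷ Kf ∷ []))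

    end-value : ∀ rem m K i p x → m + rem ≡ x → rem + (K + i) ≡ p + x → suc m + p ≡ K + suc i
    end-value rem m K i p .(m + rem) refl e = eqlin (sym e) (solve (rem ∷ m ∷ K ∷ i ∷ p ∷ []))

    continue-value : ∀ rem c K i p x y → rem + (K + i) ≡ p + x → suc c ≤ rem → x + 1 ≤ c + y → suc (K + suc i) ≤ p + y
    continue-value rem c K i p x y h₁ h₂ h₃ =
      lin (≤-reflexive h₁ ⊕ h₂ ⊕ h₃) (solve (rem ∷ c ∷ K ∷ i ∷ p ∷ x ∷ y ∷ []))

    end-state : ∀ J K K′ i b p x → J + K′ ≡ x + K → J + p ≡ K + i → b + (K′ + i) ≡ b + p + x
    end-state J K K′ i b p x e₁ e₂ = eqlin (cong₂ _+_ e₁ (sym e₂)) (solve (J ∷ K ∷ K′ ∷ i ∷ b ∷ p ∷ x ∷ []))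

    Suffix : ℕ → List ℕ → Set
    Suffix i xs = ∀ t → row xs t ≡ r (i + t)

    suffix-head : ∀ {i x xs} → Suffix i (x ∷ xs) → r i ≡ x
    suffix-head {i} rows = sym (trans (rows 0) (cong r (+-identityʳ i)))

    suffix-tail : ∀ {i x xs} → Suffix i (x ∷ xs) → Suffix (suc i) xs
    suffix-tail {i} rows t = trans (rows (suc t)) (cong r (+-suc i t))

    suffix-vanish : ∀ {i} → Suffix i [] → ∀ j → i ≤ j → r j ≡ 0
    suffix-vanish {i} rows j i≤j = sym (trans (rows (j ∸ i)) (cong r (m+[n∸m]≡n i≤j)))

    suc-∸-≤ : ∀ {rem x} → 1 ≤ rem → rem ≤ x → suc (x ∸ rem) ≤ x
    suc-∸-≤ {rem} {x} 1≤rem rem≤x = ≤-trans (+-monoˡ-≤ (x ∸ rem) 1≤rem) (≤-reflexive (m+[n∸m]≡n rem≤x))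

    outcome-last-end : ∀ x rem {i P K} → Suffix i (x ∷ []) →
      Invariant r i P K → rem + (K + i) ≡ suc P * b + r i → 1 ≤ rem → rem ≤ x → Outcome i K rem x []
    outcome-last-end x rem {i} {P} {K} rows inv state 1≤rem rem≤x =
      1 , proj₁ step , residue-last , proj₁ last ,
      subst (λ zs → ∀ t → GoodRow (i + t) (row (bump 1 zs) t)) (sym cut) (proj₁ (proj₂ last)) ,
      subst (λ zs → K ≡ sum (bump 1 zs) + proj₁ step) (sym cut) (proj₂ (proj₂ last))
      where
      r≡x : r i ≡ x
      r≡x = suffix-head rows
      vanish : ∀ j → suc i ≤ j → r j ≡ 0
      vanish = suffix-vanish (suffix-tail rows)
      J = x ∸ rem + 1
      J≡ : suc (x ∸ rem) ≡ J
      J≡ = +-comm 1 _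
      J≤r : J ≤ r i
      J≤r = subst₂ _≤_ J≡ (sym r≡x) (suc-∸-≤ 1≤rem rem≤x)
      step = invariant-end r J anti hook corner inv
        (subst (λ y → y + suc P * b ≡ K + suc i) J≡
          (end-value rem (x ∸ rem) K i (suc P * b) x (m∸n+n≡m rem≤x) (trans state (cong (suc P * b +_) r≡x))))
        (≤-trans (≤-reflexive (vanish (suc i) ≤-refl)) z≤n) J≤r
      last = good-last J J≤r vanish inv (proj₁ (proj₂ step)) (proj₂ (proj₂ step))
      cut : removeRim b rem (x ∷ []) ≡ x ∸ rem ∷ []
      cut = removeRim-end b rem x [] rem≤x
      arrange : ∀ y z → y + z + 0 ≡ y + 0 + (z + 0)
      arrange y z = solve (y ∷ z ∷ [])
      residue-last : RimResidue 1 rem (x ∷ [])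
      residue-last = subst (λ zs → Residue 1 rem (x + 0) (sum zs)) (sym cut)
        (inj₁ (refl , 0 , trans (cong (_+ 0) (sym (m∸n+n≡m rem≤x))) (arrange (x ∸ rem) rem)))

    outcome-last-continue : ∀ x rem {i P K} → Suffix i (x ∷ []) → 0 < x →
      Invariant r i P K → rem + (K + i) ≡ suc P * b + r i → rem ≤ b → x < rem → Outcome i K rem x []
    outcome-last-continue x rem {i} {P} {K} rows 0<x inv state rem≤b x<rem =
      0 , K , residue-last , proj₁ last ,
      subst (λ zs → ∀ t → GoodRow (i + t) (row (bump 0 zs) t)) (sym cut) (proj₁ (proj₂ last)) ,
      subst (λ zs → K ≡ sum (bump 0 zs) + K) (sym cut) (proj₂ (proj₂ last))
      where
      vanish : ∀ j → suc i ≤ j → r j ≡ 0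
      vanish = suffix-vanish (suffix-tail rows)
      inv′ = invariant-continue r inv (continue-value rem x K i (suc P * b) x (suc (r (suc i)))
        (trans state (cong (suc P * b +_) (suffix-head rows))) x<rem (+-monoʳ-≤ x (s≤s z≤n)))
      last = good-last 0 z≤n vanish inv inv′ (cong (_+ K) (sym (vanish (suc i) ≤-refl)))
      cut : removeRim b rem (x ∷ []) ≡ 0 ∷ []
      cut = trans (removeRim-continue b rem x [] x<rem) (cong (_∷ []) (n∸n≡0 x))
      residue-last : RimResidue 0 rem (x ∷ [])
      -- The last piece lacks `rem ∸ x` boxes, which is less than `b` because the row is nonempty.
      residue-last = subst (λ zs → Residue 0 rem (x + 0) (sum zs)) (sym cut) (inj₂ (refl , 0 , rem ∸ x , m<n⇒0<n∸m x<rem ,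
        <-≤-trans (∸-monoʳ-< 0<x (<⇒≤ x<rem)) rem≤b ,
        trans (cong (_+ (rem ∸ x)) (+-identityʳ x)) (trans (m+[n∸m]≡n (<⇒≤ x<rem)) (sym (+-identityʳ rem)))))

    outcome-end : ∀ x y xs rem {i P K} → Suffix i (x ∷ suc y ∷ xs) →
      Invariant r i P K → rem + (K + i) ≡ suc P * b + r i → 1 ≤ rem → rem ≤ x ∸ y →
      (∀ K′ → Invariant r (suc i) (suc P) K′ → b + (K′ + suc i) ≡ suc (suc P) * b + r (suc i) →
        Outcome (suc i) K′ b (suc y) xs) →
      Outcome i K rem x (suc y ∷ xs)
    outcome-end x y xs rem {i} {P} {K} rows inv state 1≤rem rem≤c recurse = conclude (recurse K′ inv′ state′)
      where
      r≡x : r i ≡ x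
      r≡x = suffix-head rows
      r≡y : r (suc i) ≡ suc y
      r≡y = suffix-head (suffix-tail rows)
      y≤x : y ≤ x
      y≤x = ≤-trans (n≤1+n y) (subst₂ _≤_ r≡y r≡x (anti i))
      rem≤x : rem ≤ x
      rem≤x = ≤-trans rem≤c (m∸n≤m x y)
      ended : suc (x ∸ rem) + suc P * b ≡ K + suc i
      ended = end-value rem (x ∸ rem) K i (suc P * b) x (m∸n+n≡m rem≤x) (trans state (cong (suc P * b +_) r≡x))
      fits : suc (x ∸ rem) ≤ r i
      fits = subst (suc (x ∸ rem) ≤_) (sym r≡x) (suc-∸-≤ 1≤rem rem≤x)
      step = invariant-end r (suc (x ∸ rem)) anti hook corner inv ended
        (≤-trans (≤-reflexive r≡y) (s≤s (≤-trans (≤-reflexive (sym (m∸[m∸n]≡n y≤x))) (∸-monoʳ-≤ x rem≤c)))) fits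
      K′ = proj₁ step
      inv′ = proj₁ (proj₂ step)
      exchanged = proj₂ (proj₂ step)
      state′ : b + (K′ + suc i) ≡ suc (suc P) * b + r (suc i)
      state′ = end-state (suc (x ∸ rem)) K K′ (suc i) b (suc P * b) (r (suc i)) exchanged ended
      conclude : Outcome (suc i) K′ b (suc y) xs → Outcome i K rem x (suc y ∷ xs)
      conclude (δ , Kf , res , rest) = outcome-cons (x ∸ rem) x (suc y) xs fits (sym r≡y) inv inv′ exchanged
        (removeRim-end b rem x (suc y ∷ xs) rem≤c) (rim-residue-end δ rem x (suc y ∷ xs) rem≤x rem≤c res) (Kf , rest)

    -- The whole rim segment of the row is removed, so after `bump` its length is `r (suc i)` and
    -- `K` is unchanged.
    outcome-continue : ∀ x y xs rem {i P K} → Suffix i (x ∷ suc y ∷ xs) →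
      Invariant r i P K → rem + (K + i) ≡ suc P * b + r i → x ∸ y < rem →
      (Invariant r (suc i) P K → rem ∸ (x ∸ y) + (K + suc i) ≡ suc P * b + r (suc i) →
        Outcome (suc i) K (rem ∸ (x ∸ y)) (suc y) xs) →
      Outcome i K rem x (suc y ∷ xs)
    outcome-continue x y xs rem {i} {P} {K} rows inv state c<rem recurse = conclude (recurse inv′ state′)
      where
      c = x ∸ y
      r≡x : r i ≡ x
      r≡x = suffix-head rows
      r≡y : r (suc i) ≡ suc y
      r≡y = suffix-head (suffix-tail rows)
      1+y≤x : suc y ≤ x
      1+y≤x = subst₂ _≤_ r≡y r≡x (anti i)
      y≤x : y ≤ x
      y≤x = ≤-trans (n≤1+n y) 1+y≤x
      x≡ : x ≡ c + y
      x≡ = sym (m∸n+n≡m y≤x)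
      wide : ∀ c y → c + y + 1 + 1 ≡ c + suc (suc y)
      wide c y = solve (c ∷ y ∷ [])
      inv′ = invariant-continue r inv (subst (λ z → suc (K + suc i) ≤ suc P * b + suc z) (sym r≡y)
        (continue-value rem c K i (suc P * b) x (suc (suc y)) (trans state (cong (suc P * b +_) r≡x)) c<rem
          (subst (λ z → z + 1 ≤ c + suc (suc y)) (sym x≡) (≤-trans (m≤m+n _ 1) (≤-reflexive (wide c y))))))
      move : ∀ w c K i p y → w + c + (K + i) ≡ p + (c + y) → w + (K + suc i) ≡ p + suc y
      move w c K i p y e = eqlin e (solve (w ∷ c ∷ K ∷ i ∷ p ∷ y ∷ []))
      state′ : rem ∸ c + (K + suc i) ≡ suc P * b + r (suc i)
      state′ = trans (move (rem ∸ c) c K i (suc P * b) y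
        (trans (cong (_+ (K + i)) (m∸n+n≡m (<⇒≤ c<rem))) (trans state (cong (suc P * b +_) (trans r≡x x≡)))))
        (cong (suc P * b +_) (sym r≡y))
      conclude : Outcome (suc i) K (rem ∸ c) (suc y) xs → Outcome i K rem x (suc y ∷ xs)
      conclude (δ , Kf , res , rest) = outcome-cons y x (suc y) xs (subst (suc y ≤_) (sym r≡x) 1+y≤x) (sym r≡y) inv inv′
        (cong (_+ K) (sym r≡y))
        (trans (removeRim-continue b rem x (suc y ∷ xs) c<rem)
          (cong (_∷ removeRim b (rem ∸ c) (suc y ∷ xs)) (m∸[m∸n]≡n y≤x)))
        (rim-residue-continue δ rem x (suc y ∷ xs) c refl (m∸n≤m x y) c<rem res) (Kf , rest)

    -- A piece started in row s has taken r s - r i + i - s boxes on reaching row `i`; inserting K +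
    -- s = r s + P b turns this into the equation for `rem`.
    rim-outcome : ∀ xs x rem {i P K} → Suffix i (x ∷ xs) → All (0 <_) (x ∷ xs) →
      Invariant r i P K → rem + (K + i) ≡ suc P * b + r i → 1 ≤ rem → rem ≤ b → Outcome i K rem x xs
    rim-outcome [] x rem rows (0<x All.∷ All.[]) inv state 1≤rem rem≤b with rem ≤? x
    ... | yes rem≤x = outcome-last-end x rem rows inv state 1≤rem rem≤x
    ... | no  rem≰x = outcome-last-continue x rem rows 0<x inv state rem≤b (≰⇒> rem≰x)
    rim-outcome (zero ∷ xs) x rem rows (_ All.∷ () All.∷ _)
    rim-outcome (suc y ∷ xs) x rem rows (_ All.∷ pos) inv state 1≤rem rem≤b with rem ≤? x ∸ y
    ... | yes rem≤c = outcome-end x y xs rem rows inv state 1≤rem rem≤c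
            (λ K′ inv′ state′ → rim-outcome xs (suc y) b (suffix-tail rows) pos inv′ state′ (s≤s z≤n) ≤-refl)
    ... | no  rem≰c = outcome-continue x y xs rem rows inv state (≰⇒> rem≰c)
            (λ inv′ state′ → rim-outcome xs (suc y) (rem ∸ (x ∸ y)) (suffix-tail rows) pos inv′ state′
              (m<n⇒0<n∸m (≰⇒> rem≰c)) (≤-trans (m∸n≤m rem (x ∸ y)) rem≤b))

  -- J_b as a successor, and its iteration.

  Jb-residue : ∀ δ λs → RimResidue δ b λs → Jb b λs ≡ stripZ (bump δ (Ib b λs))
  Jb-residue δ λs res = cong (λ z → stripZ (bump z (Ib b λs))) (delta res)
    where
    φ = sum λs ∸ sum (Ib b λs)
    delta : RimResidue δ b λs → (if does (b ∣? φ) then 1 else 0) ≡ δ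
    delta (inj₁ (refl , n , e)) = cong (if_then 1 else 0) (dec-true (b ∣? φ)
      (divides (suc n) (trans (cong (_∸ sum (Ib b λs)) e) (m+n∸m≡n (sum (Ib b λs)) _))))
    delta (inj₂ (refl , n , t , 0<t , t<b , e)) = cong (if_then 1 else 0) (dec-false (b ∣? φ) λ b∣φ →
      <⇒≱ t<b (∣⇒≤ {{>-nonZero 0<t}} (∣m+n∣m⇒∣n (divides (suc n) φ+t) b∣φ)))
      where
      open ≡-Reasoning
      small : sum (Ib b λs) ≤ sum λs
      small = +-cancelʳ-≤ t _ _ (≤-trans (+-monoʳ-≤ _ (≤-trans (<⇒≤ t<b) (m≤m+n b (n * b)))) (≤-reflexive (sym e)))
      φ+t : φ + t ≡ suc n * b
      φ+t = begin
        φ + t                                       ≡⟨ +-∸-comm t small ⟨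
        sum λs + t ∸ sum (Ib b λs)                  ≡⟨ cong (_∸ sum (Ib b λs)) e ⟩
        sum (Ib b λs) + suc n * b ∸ sum (Ib b λs)   ≡⟨ m+n∸m≡n (sum (Ib b λs)) _ ⟩
        suc n * b                                   ∎

  Jb-spec : ∀ x xs → let λs = x ∷ xs in Anti (row λs) → All (0 <_) λs → HookCond (row λs) → Cornered (row λs) →
    ∃ λ K → Global (row λs) K × Successor (row λs) (row (Jb b λs))
      × Anti (row (Jb b λs)) × All (0 <_) (Jb b λs) × sum λs ≡ sum (Jb b λs) + K
  Jb-spec x xs anti pos hook corner
    with rim-outcome (row (x ∷ xs)) anti hook corner xs x b {0} {0} (λ _ → refl) pos
           (invariant-start (row (x ∷ xs))) (solve-start b x) (s≤s z≤n) ≤-refl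
    where
    solve-start : ∀ b x → b + (x + 0) ≡ 1 * b + x
    solve-start b x = solve (b ∷ x ∷ [])
  ... | δ , K , res , glob , good , total rewrite Jb-residue δ (x ∷ xs) res =
    K , glob , next , anti-J , stripZ-positive B anti-B ,
    trans (+-comm x (sum xs)) (trans total (cong (_+ K) (sym (sum-stripZ B))))
    where
    r = row (x ∷ xs)
    B = bump δ (Ib b (x ∷ xs))
    next-B : Successor r (row B)
    next-B i = proj₁ (good i)
    next : Successor r (row (stripZ B))
    next i = subst (SuccessorRow r i) (sym (row-stripZ B i)) (next-B i)
    anti-B : Anti (row B)
    anti-B i = ≤-trans (proj₂ (good (suc i))) (successor-≥ r (row B) next-B i)
    anti-J : Anti (row (stripZ B))
    anti-J i = subst₂ _≤_ (sym (row-stripZ B (suc i))) (sym (row-stripZ B i)) (anti-B i)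

  -- A point of row 0 survives only if its ladder misses no box, that is, if its column is left of
  -- every level.
  first-row : ∀ r s K → Regularizes r s → Global r K → s 0 ≡ K
  first-row r s K reg (low , g , K≡) = ≤-antisym (≮⇒≥ λ K<s → <⇒≱ (deficit-pos r g (≤-reflexive (sym K≡)))
      (subst (λ Y → deficit r 0 Y ≤ 0) (+-identityʳ K) (proj₂ (reg 0 0 K (s≤s z≤n)) K<s)))
    (≮⇒≥ λ s<K → <-irrefl refl (proj₁ (reg 0 0 (s 0) (s≤s z≤n))
      (≤-reflexive (sumTo-zero (suc (s 0 + 0)) (λ t → ind-no (<-≤-trans
        (subst (_< K) (sym (+-identityʳ (s 0))) s<K) (low t)))))))

  -- Each J_b strips the first row of `μ`, whose length is the size drop; this row is nonempty, so
  -- the fuel suffices.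
  mullineux≡regularization : ∀ fuel λs μ → Anti (row λs) → All (0 <_) λs → Anti (row μ) → All (0 <_) μ →
    sum λs ≤ fuel → Regularizes (row λs) (row μ) → HookCond (row λs) → mbtrGo b fuel λs ≡ μ
  mullineux≡regularization fuel [] [] _ _ _ _ _ _ _ = empty fuel
    where
    empty : ∀ fuel → mbtrGo b fuel [] ≡ []
    empty zero    = refl
    empty (suc _) = refl
  -- The corner box is a ladder by itself, so it lies in both diagrams or in neither.
  mullineux≡regularization fuel [] (h ∷ μ) _ _ _ (0<h All.∷ _) _ reg _ =
    ⊥-elim (<⇒≱ (s≤s z≤n) (proj₂ (reg 0 0 0 (s≤s z≤n)) 0<h))
  mullineux≡regularization zero (suc x ∷ λs) μ _ _ _ _ () _ _
  mullineux≡regularization zero (zero ∷ λs) μ _ (() All.∷ _) _ _ _ _ _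
  mullineux≡regularization (suc fuel) (x ∷ λs) [] _ (0<x All.∷ _) _ _ _ reg _
    with proj₁ (reg 0 0 0 (s≤s z≤n)) (≤-reflexive (trans (+-identityʳ _) (ind-no (subst (0 <_) (sym (+-identityʳ x)) 0<x))))
  ... | ()
  mullineux≡regularization (suc fuel) (x ∷ λs) (h ∷ μ) anti pos anti-μ (0<h All.∷ pos-μ) size reg hook
    with Jb-spec x λs anti pos hook (regularizes⇒cornered (row (x ∷ λs)) (row (h ∷ μ)) anti-μ reg)
  ... | K , glob , next , anti-J , pos-J , total = cong₂ _∷_
    (trans (cong (_∸ sum (Jb b (x ∷ λs))) total) (trans (m+n∸m≡n (sum (Jb b (x ∷ λs))) K) (sym h≡K)))
    (mullineux≡regularization fuel (Jb b (x ∷ λs)) μ anti-J pos-J (anti-μ ∘ suc) pos-μ smaller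
      (regularizes-successor r (row (Jb b (x ∷ λs))) (row (h ∷ μ)) next reg)
      (hook-successor r (row (Jb b (x ∷ λs))) anti anti-J next hook))
    where
    r = row (x ∷ λs)
    h≡K : h ≡ K
    h≡K = first-row r (row (h ∷ μ)) K reg glob
    smaller : sum (Jb b (x ∷ λs)) ≤ fuel
    smaller = s≤s⁻¹ (≤-trans (≤-trans (m<m+n _ (subst (0 <_) h≡K 0<h)) (≤-reflexive (sym total))) size)

  -- Ladder lists and membership in the regularization.

  b∸a≡d : b ∸ a ≡ d
  b∸a≡d = m+n∸m≡n a d

  below-more : ∀ f x y → d < y → ladderBelow a b (suc f) x y ≡ (x + a , y ∸ d) ∷ ladderBelow a b f (x + a) (y ∸ d)
  below-more f x y d<y = trans
    (cong (λ δ → if suc δ ≤ᵇ y then (x + a , y ∸ δ) ∷ ladderBelow a b f (x + a) (y ∸ δ) else []) b∸a≡d)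
    (cong (if_then (x + a , y ∸ d) ∷ ladderBelow a b f (x + a) (y ∸ d) else []) (≤ᵇ-true d<y))

  below-none : ∀ f x y → y ≤ d → ladderBelow a b f x y ≡ []
  below-none zero    x y y≤d = refl
  below-none (suc f) x y y≤d = trans
    (cong (λ δ → if suc δ ≤ᵇ y then (x + a , y ∸ δ) ∷ ladderBelow a b f (x + a) (y ∸ δ) else []) b∸a≡d)
    (cong (if_then (x + a , y ∸ d) ∷ ladderBelow a b f (x + a) (y ∸ d) else []) (≤ᵇ-false (s≤s y≤d)))

  above-more : ∀ f x y → a < x → ladderAbove a b (suc f) x y ≡ (x ∸ a , y + d) ∷ ladderAbove a b f (x ∸ a) (y + d)
  above-more f x y a<x = trans
    (cong (λ δ → if suc a ≤ᵇ x then (x ∸ a , y + δ) ∷ ladderAbove a b f (x ∸ a) (y + δ) else []) b∸a≡d)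
    (cong (if_then (x ∸ a , y + d) ∷ ladderAbove a b f (x ∸ a) (y + d) else []) (≤ᵇ-true a<x))

  above-none : ∀ f x y → x ≤ a → ladderAbove a b f x y ≡ []
  above-none zero    x y x≤a = refl
  above-none (suc f) x y x≤a =
    cong (if_then (x ∸ a , y + (b ∸ a)) ∷ ladderAbove a b f (x ∸ a) (y + (b ∸ a)) else []) (≤ᵇ-false (s≤s x≤a))

  module _ (λs : List ℕ) where

    private
      r = row λs
      miss = misses (inDiagᵇ λs)

    ind-+ : ∀ x y z → ind (x + z) (y + z) ≡ ind x y
    ind-+ x y z = ind-cong {x + z} {y + z} {x} {y} (+-cancelʳ-≤ z x y) (+-monoˡ-≤ z)

    misses-below : ∀ f i y → y ≤ f →
      miss (ladderBelow a b f (suc i) (suc y)) ≡ sumTo f (λ t → ind (r (i + suc t * a) + suc t * d) y)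
    misses-below zero    i y y≤f = refl
    misses-below (suc f) i y y≤f with d ≤? y
    ... | no  d≰y = trans (cong miss (below-none (suc f) (suc i) (suc y) (≰⇒> d≰y)))
        (sym (sumTo-zero (suc f) (λ t → ind-no (<-≤-trans (≰⇒> d≰y) (≤-trans (m≤m+n d (t * d)) (m≤n+m _ (r (i + suc t * a))))))))
    ... | yes d≤y = begin
      miss (ladderBelow a b (suc f) (suc i) (suc y))
        ≡⟨ cong miss (below-more f (suc i) (suc y) (s≤s d≤y)) ⟩
      miss ((suc i + a , suc y ∸ d) ∷ ladderBelow a b f (suc i + a) (suc y ∸ d))
        ≡⟨ cong (λ z → miss ((suc i + a , z) ∷ ladderBelow a b f (suc i + a) z)) (+-∸-assoc 1 d≤y) ⟩
      miss ((suc (i + a) , suc z) ∷ ladderBelow a b f (suc (i + a)) (suc z))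
        ≡⟨ cong₂ _+_ (trans (miss-point λs (i + a) z) first)
             (trans (misses-below f (i + a) z z≤f) (sumTo-cong f rest)) ⟩
      sumTo (suc f) (λ t → ind (r (i + suc t * a) + suc t * d) y) ∎
      where
      open ≡-Reasoning
      z = y ∸ d
      z+d : z + d ≡ y
      z+d = m∸n+n≡m d≤y
      z≤f : z ≤ f
      z≤f = s≤s⁻¹ (≤-trans (≤-trans (s≤s (m≤m+n z d′)) (≤-reflexive (trans (sym (+-suc z d′)) z+d))) y≤f)
      shift : ∀ x k → ind (x + k) z ≡ ind (x + (d + k)) y
      shift x k = trans (sym (ind-+ (x + k) z d)) (cong₂ ind (trans (+-assoc x k d) (cong (x +_) (+-comm k d))) z+d)
      first : ind (r (i + a)) z ≡ ind (r (i + 1 * a) + 1 * d) y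
      first = trans (cong (λ x → ind x z) (sym (+-identityʳ (r (i + a)))))
        (trans (shift (r (i + a)) 0) (cong (λ k → ind (r (i + k) + (d + 0)) y) (sym (*-identityˡ a))))
      rest : ∀ t → ind (r (i + a + suc t * a) + suc t * d) z ≡ ind (r (i + suc (suc t) * a) + suc (suc t) * d) y
      rest t = trans (shift (r (i + a + suc t * a)) (suc t * d))
        (cong (λ k → ind (r k + suc (suc t) * d) y) (+-assoc i a (suc t * a)))

    -- The list runs northwards, so its head carries the largest index and the sum grows at its end.
    -- As `i < a`, it stops after exactly `u` points.
    misses-above : ∀ {i} → i < a → ∀ f u y → u ≤ f →
      miss (ladderAbove a b f (suc (i + u * a)) (suc y)) ≡ sumTo u (gap r i (y + u * d))
      × length (ladderAbove a b f (suc (i + u * a)) (suc y)) ≡ u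
    misses-above {i} i<a f zero y u≤f
      rewrite above-none f (suc (i + 0)) (suc y) (subst (_≤ a) (cong suc (sym (+-identityʳ i))) i<a) = refl , refl
    misses-above {i} i<a (suc f) (suc u) y (s≤s u≤f)
      with misses-above i<a f u (y + d) u≤f
    ... | count , len = (begin
        miss (ladderAbove a b (suc f) (suc (i + suc u * a)) (suc y))
          ≡⟨ cong miss step ⟩
        (if inDiagᵇ λs (suc (i + u * a) , suc (y + d)) then 0 else 1) + miss next
          ≡⟨ cong₂ _+_ (miss-point λs (i + u * a) (y + d)) count ⟩
        ind (r (i + u * a)) (y + d) + sumTo u (gap r i (y + d + u * d))
          ≡⟨ +-comm (ind (r (i + u * a)) (y + d)) _ ⟩
        sumTo u (gap r i (y + d + u * d)) + ind (r (i + u * a)) (y + d)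
          ≡⟨ cong (sumTo u (gap r i (y + d + u * d)) +_) (ind-+ (r (i + u * a)) (y + d) (u * d)) ⟨
        sumTo u (gap r i (y + d + u * d)) + gap r i (y + d + u * d) u
          ≡⟨ sumTo-snoc u (gap r i (y + d + u * d)) ⟨
        sumTo (suc u) (gap r i (y + d + u * d))
          ≡⟨ cong (λ Y → sumTo (suc u) (gap r i Y)) (+-assoc y d (u * d)) ⟩
        sumTo (suc u) (gap r i (y + suc u * d)) ∎) ,
        trans (cong length step) (cong suc len)
      where
      open ≡-Reasoning
      next = ladderAbove a b f (suc (i + u * a)) (suc (y + d))
      back : suc (i + suc u * a) ∸ a ≡ suc (i + u * a)
      back = trans (cong (_∸ a) (regroup i u a)) (m+n∸m≡n a _)
        where
        regroup : ∀ i u a → suc (i + suc u * a) ≡ a + suc (i + u * a)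
        regroup i u a = solve (i ∷ u ∷ a ∷ [])
      step : ladderAbove a b (suc f) (suc (i + suc u * a)) (suc y) ≡ (suc (i + u * a) , suc (y + d)) ∷ next
      step = trans (above-more f (suc (i + suc u * a)) (suc y) (s≤s (≤-trans (m≤m+n a (u * a)) (m≤n+m _ i))))
        (cong (λ x → (x , suc (y + d)) ∷ ladderAbove a b f x (suc (y + d))) back)

    ladder-misses : ∀ i u y → i < a →
      miss (ladder a b (suc (i + u * a)) (suc y)) ≡ deficit r i (y + u * d)
    ladder-misses i u y i<a = begin
      miss (ladder a b x (suc y))
        ≡⟨ trans (misses-++ (inDiagᵇ λs) (reverse below) _) (cong (_+ miss ((x , suc y) ∷ above)) (misses-reverse (inDiagᵇ λs) below)) ⟩
      miss below + ((if inDiagᵇ λs (x , suc y) then 0 else 1) + miss above)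
        ≡⟨ cong₂ _+_ (misses-below (suc y) (i + u * a) y (n≤1+n y))
             (cong₂ _+_ (miss-point λs (i + u * a) y) (proj₁ (misses-above i<a x u y u≤x))) ⟩
      sumTo (suc y) tail + (ind (r (i + u * a)) y + sumTo u (gap r i Y))
        ≡⟨ rotate (sumTo (suc y) tail) (ind (r (i + u * a)) y) (sumTo u (gap r i Y)) ⟩
      sumTo u (gap r i Y) + (ind (r (i + u * a)) y + sumTo (suc y) tail)
        ≡⟨ cong (sumTo u (gap r i Y) +_) (cong₂ _+_ first (sumTo-cong (suc y) (λ t → sym (term (suc t))))) ⟩
      sumTo u (gap r i Y) + sumTo (suc (suc y)) (λ t → gap r i Y (u + t))
        ≡⟨ sumTo-+ u (suc (suc y)) (gap r i Y) ⟨
      sumTo (u + suc (suc y)) (gap r i Y)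
        ≡⟨ deficit-tail r i (u + suc (suc y)) enough ⟩
      deficit r i Y ∎
      where
      open ≡-Reasoning
      x = suc (i + u * a)
      Y = y + u * d
      below = ladderBelow a b (suc y) x (suc y)
      above = ladderAbove a b x x (suc y)
      tail : ℕ → ℕ
      tail t = ind (r (i + u * a + suc t * a) + suc t * d) y
      u≤x : u ≤ x
      u≤x = m≤n⇒m≤1+n (≤-trans (m≤m*n u a) (m≤n+m _ i))
      rotate : ∀ p q s → p + (q + s) ≡ s + (q + p)
      rotate p q s = solve (p ∷ q ∷ s ∷ [])
      term : ∀ t → gap r i Y (u + t) ≡ ind (r (i + u * a + t * a) + t * d) y
      term t = trans (cong₂ (λ k l → ind (r k + l) Y) (rows i u t a) (cols u t d))
        (trans (cong (λ k → ind k Y) (sym (+-assoc (r (i + u * a + t * a)) (t * d) (u * d)))) (ind-+ (r (i + u * a + t * a) + t * d) y (u * d)))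
        where
        rows : ∀ i u t a → i + (u + t) * a ≡ i + u * a + t * a
        rows i u t a = solve (i ∷ u ∷ t ∷ a ∷ [])
        cols : ∀ u t d → (u + t) * d ≡ t * d + u * d
        cols u t d = solve (u ∷ t ∷ d ∷ [])
      first : ind (r (i + u * a)) y ≡ gap r i Y (u + 0)
      first = sym (trans (term 0) (cong (λ k → ind k y) (trans (+-identityʳ _) (cong r (+-identityʳ _)))))
      enough : Y < (u + suc (suc y)) * d
      enough = ≤-trans (+-monoˡ-≤ (u * d) (≤-trans (n≤1+n (suc y)) (m≤m*d (suc (suc y)))))
        (≤-reflexive (trans (sym (*-distribʳ-+ d (suc (suc y)) u)) (cong (_* d) (+-comm (suc (suc y)) u))))

    -- Exactly `u` points of the ladder lie strictly north, so having more boxes than points to the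
    -- south means having at most `u` absences.
    InCr⇔deficit : ∀ i u y → i < a →
      (InCr a b λs (suc (i + u * a)) (suc y) → deficit r i (y + u * d) ≤ u)
      × (deficit r i (y + u * d) ≤ u → InCr a b λs (suc (i + u * a)) (suc y))
    InCr⇔deficit i u y i<a =
      (λ (_ , _ , h) → to h) , (λ h → s≤s z≤n , s≤s z≤n , from h)
      where
      x = suc (i + u * a)
      below = ladderBelow a b (suc y) x (suc y)
      above = ladderAbove a b x x (suc y)
      total : ladderCount a b λs x (suc y) + deficit r i (y + u * d) ≡ length below + suc u
      total = trans (cong (ladderCount a b λs x (suc y) +_) (sym (ladder-misses i u y i<a)))
        (trans (filter+misses (inDiagᵇ λs) (ladder a b x (suc y)))
        (trans (length-++ (reverse below))
          (cong₂ _+_ (length-reverse below)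
            (cong suc (proj₂ (misses-above i<a x u y (m≤n⇒m≤1+n (≤-trans (m≤m*n u a) (m≤n+m _ i)))))))))
      to′ : ∀ c n m u → c + m ≡ n + suc u → suc n ≤ c → m ≤ u
      to′ c n m u e h = lin (≤-reflexive e ⊕ h) (solve (c ∷ n ∷ m ∷ u ∷ []))
      from′ : ∀ c n m u → c + m ≡ n + suc u → m ≤ u → suc n ≤ c
      from′ c n m u e h = lin (≤-reflexive (sym e) ⊕ h) (solve (c ∷ n ∷ m ∷ u ∷ []))
      to   = to′ (ladderCount a b λs x (suc y)) (length below) (deficit r i (y + u * d)) u total
      from = from′ (ladderCount a b λs x (suc y)) (length below) (deficit r i (y + u * d)) u total

  -- Regularity, and the hook bound without fractions.

  regular : ∀ λs → Anti (row λs) → HookCond (row λs) → Regular b λs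
  regular λs anti hook (suc i , _ , 0<r , constant) = go (row λs i) refl 0<r
    where
    r = row λs
    go : ∀ x → x ≡ r i → 0 < x → ⊥
    go (suc j) x≡ _
      -- Let `e` be the last row of the final column `j` of the equal rows. The box `b - 1` rows
      -- above `e` still has arm 0, hence hook length `b` and a leg of `b - 1`, which is at least
      -- `a`.
      with column-end r (length λs) (i + (a′ + d)) j
        (≤-trans (≤-reflexive x≡) (≤-reflexive (sym (constant (a′ + d) ≤-refl))))
        (≤-trans (≤-reflexive (row-beyond λs _ (m≤n+m _ _))) z≤n)
    ... | e , i₁≤e , above , below =
      <⇒≱ (hook i₂ e j 1 (m∸n≤m e (a′ + d)) above below (trans (cong₂ _+_ same (cong suc (sym e≡))) (total j i₂ (a′ + d))))
        (subst (i₂ + 1 * a ≤_) e≡ (+-monoʳ-≤ i₂ (≤-trans (≤-reflexive (*-identityˡ a)) (≤-trans (s≤s (m≤m+n a′ d′)) (≤-reflexive (sym (+-suc a′ d′)))))))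
      where
      i₂ = e ∸ (a′ + d)
      e≡ : i₂ + (a′ + d) ≡ e
      e≡ = m∸n+n≡m (≤-trans (m≤n+m (a′ + d) i) i₁≤e)
      i≤i₂ : i ≤ i₂
      i≤i₂ = +-cancelʳ-≤ (a′ + d) _ _ (≤-trans i₁≤e (≤-reflexive (sym e≡)))
      same : r i₂ ≡ suc j
      same = ≤-antisym (≤-trans (anti-≤ r anti i≤i₂) (≤-reflexive (sym x≡))) (≤-trans above (anti-≤ r anti (m∸n≤m e (a′ + d))))
      total : ∀ j i c → suc j + suc (i + c) ≡ 1 * suc c + (i + suc j)
      total j i c = solve (j ∷ i ∷ c ∷ [])

  -- Unnormalised representatives expose the denominators `a` and 1, so the comparison becomes a
  -- cross-multiplication.
  slope : ∀ l A → ((ℤ.+ b ℚ./ a) ℚ.- ℚ.1ℚ) ℚ.* (ℤ.+ l ℚ./ 1) ℚ.< (ℤ.+ (A + 1) ℚ./ 1) → d * l < a * (A + 1)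
  slope l A h with ℚᵘ.<-respʳ-≃ (ℚ.toℚᵘ-fromℚᵘ (ℚᵘ.mkℚᵘ (ℤ.+ (A + 1)) 0)) (ℚᵘ.<-respˡ-≃ expand (ℚ.toℚᵘ-mono-< h))
    where
    ba = ℤ.+ b ℚ./ a
    l₁ = ℤ.+ l ℚ./ 1
    expand : ℚ.toℚᵘ ((ba ℚ.- ℚ.1ℚ) ℚ.* l₁) ℚᵘ.≃ (ℚᵘ.mkℚᵘ (ℤ.+ b) a′ ℚᵘ.- ℚᵘ.1ℚᵘ) ℚᵘ.* ℚᵘ.mkℚᵘ (ℤ.+ l) 0
    expand = ℚᵘ.≃-trans (ℚ.toℚᵘ-homo-* (ba ℚ.- ℚ.1ℚ) l₁)
      (ℚᵘ.*-cong (ℚᵘ.≃-trans (ℚ.toℚᵘ-homo-+ ba (ℚ.- ℚ.1ℚ))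
        (ℚᵘ.+-cong (ℚ.toℚᵘ-fromℚᵘ (ℚᵘ.mkℚᵘ (ℤ.+ b) a′)) ℚᵘ.≃-refl)) (ℚ.toℚᵘ-fromℚᵘ (ℚᵘ.mkℚᵘ (ℤ.+ l) 0)))
  ... | ℚᵘ.*<* lt = ℤ.drop‿+<+ (subst₂ ℤ._<_ left right lt)
    where
    numerator : ℤ.+ b ℤ.* ℤ.1ℤ ℤ.+ ℤ.-1ℤ ℤ.* ℤ.+ a ≡ ℤ.+ d
    numerator = trans (cong₂ ℤ._+_ (ℤ.*-identityʳ (ℤ.+ b)) (ℤ.-1*i≡-i (ℤ.+ a)))
      (trans (ℤ.m-n≡m⊖n b a) (trans (ℤ.⊖-≥ (m≤m+n a d)) (cong ℤ.+_ (m+n∸m≡n a d))))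
    left : (ℤ.+ b ℤ.* ℤ.1ℤ ℤ.+ ℤ.-1ℤ ℤ.* ℤ.+ a) ℤ.* ℤ.+ l ℤ.* ℤ.1ℤ ≡ ℤ.+ (d * l)
    left = trans (ℤ.*-identityʳ _) (trans (cong (ℤ._* ℤ.+ l) numerator) (sym (ℤ.pos-* d l)))
    right : ℤ.+ (A + 1) ℤ.* ℤ.+ (a * 1 * 1) ≡ ℤ.+ (a * (A + 1))
    right = trans (sym (ℤ.pos-* (A + 1) (a * 1 * 1)))
      (cong ℤ.+_ (trans (*-comm (A + 1) (a * 1 * 1)) (cong (_* (A + 1)) (trans (*-identityʳ _) (*-identityʳ a)))))

  HookBound : List ℕ → Set
  HookBound λs = ∀ i j → InDiag λs i j → b ∣ hook λs i j →
    ((ℤ.+ b ℚ./ a) ℚ.- ℚ.1ℚ) ℚ.* (ℤ.+ leg λs i j ℚ./ 1) ℚ.< (ℤ.+ (arm λs i j + 1) ℚ./ 1)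

  -- Combining `d * l < a * (A + 1)` with `a` times `1 + A + l ≡ m * b` gives `l * b < m * a * b`,
  -- and `b` cancels.
  hookBound⇒hookCond : ∀ λs → Anti (row λs) → HookBound λs → HookCond (row λs)
  hookBound⇒hookCond λs anti bound i e j m i≤e above below eq =
    ≤-trans (≤-reflexive (cong suc (sym e≡))) (≤-trans (s≤s (≤-reflexive (+-comm l i))) (≤-trans (≤-reflexive (sym (+-suc i l))) (+-monoʳ-≤ i l<ma)))
    where
    r = row λs
    l = e ∸ i
    A = r i ∸ suc j
    j<ri : j < r i
    j<ri = ≤-trans above (anti-≤ r anti i≤e)
    A≡ : A + suc j ≡ r i
    A≡ = m∸n+n≡m j<ri
    e≡ : l + i ≡ e
    e≡ = m∸n+n≡m i≤e
    leg≡ : leg λs (suc i) (suc j) ≡ l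
    leg≡ = cong (_∸ suc i) (conj-corner λs j e anti above below)
    total : ∀ A l i j k → A + suc j + suc (l + i) ≡ k + (i + suc j) → 1 + A + l ≡ k
    total A l i j k h = eqlin h (solve (A ∷ l ∷ i ∷ j ∷ k ∷ []))
    length≡ : 1 + A + l ≡ m * b
    length≡ = total A l i j (m * b) (trans (cong₂ (λ x y → x + suc y) A≡ e≡) eq)
    steep : d * l < a * (A + 1)
    steep = slope l A (subst (λ k → ((ℤ.+ b ℚ./ a) ℚ.- ℚ.1ℚ) ℚ.* (ℤ.+ k ℚ./ 1) ℚ.< (ℤ.+ (A + 1) ℚ./ 1)) leg≡
      (bound (suc i) (suc j) (s≤s z≤n , s≤s z≤n , j<ri) (divides m (trans (cong (1 + A +_) leg≡) length≡))))
    scale : ∀ a d l A m → suc (d * l) ≤ a * (A + 1) → a * (1 + A + l) ≡ a * (m * (a + d)) →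
      suc (l * (a + d)) ≤ m * a * (a + d)
    scale a d l A m h₁ h₂ = lin (h₁ ⊕ ≤-reflexive h₂) (solve (a ∷ d ∷ l ∷ A ∷ m ∷ []))
    l<ma : l < m * a
    l<ma = *-cancelʳ-< b l (m * a) (scale a d l A m steep (cong (a *_) length≡))

  mullineux-regular : ∀ λs → IsPartition λs → ∀ μ → IsPartition μ →
    (∀ x y → 1 ≤ x → 1 ≤ y → InCr a b λs x y ⇔ InDiag μ x y) → HookBound λs →
    Regular b λs × MbTr b λs ≡ μ
  mullineux-regular λs (linked , pos) μ (linked-μ , pos-μ) cr bound =
    regular λs anti hooks ,
    mullineux≡regularization (sum λs) λs μ anti pos (linked⇒anti linked-μ) pos-μ ≤-refl regularizes hooks
    where
    anti : Anti (row λs)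
    anti = linked⇒anti linked
    hooks : HookCond (row λs)
    hooks = hookBound⇒hookCond λs anti bound
    regularizes : Regularizes (row λs) (row μ)
    regularizes i u y i<a =
      (λ h → proj₂ (proj₂ (Equivalence.to box (proj₂ iff h)))) ,
      (λ h → proj₁ iff (Equivalence.from box (s≤s z≤n , s≤s z≤n , h)))
      where
      box = cr (suc (i + u * a)) (suc y) (s≤s z≤n) (s≤s z≤n)
      iff = InCr⇔deficit λs i u y i<a

-- The theorem for arbitrary `a < b`.

open import Data.Nat using (_<_; _≤_; NonZero; suc; ≢-nonZero⁻¹)
open import Data.Nat.Properties using (m≤n⇒∃[o]m+o≡n; +-suc)
open import Data.Nat.Divisibility using (_∣_)
open import Data.Integer using (+_)
open import Data.Rational using (ℚ; _/_; _-_; _*_; 1ℚ) renaming (_<_ to _<ℚ_)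
open import Function.Bundles using (_⇔_)
open Ladders using (mullineux-regular)

-- Named so that it can be transported along b ≡ suc a′ + suc d′ in one step.
RegularizationClaim : (a b : ℕ) → .{{_ : NonZero a}} → Set
RegularizationClaim a b =
    (λs : List ℕ) → IsPartition λs →
    (μ : List ℕ) → IsPartition μ →
    ((x y : ℕ) → 1 ≤ x → 1 ≤ y → InCr a b λs x y ⇔ InDiag μ x y) →
    ((i j : ℕ) → InDiag λs i j → b ∣ hook λs i j →
    ((+ b / a) - 1ℚ) * (+ leg λs i j / 1) <ℚ (+ (arm λs i j Data.Nat.+ 1) / 1)) →
    Regular b λs × MbTr b λs ≡ μ

theorem1p2 : (a b : ℕ) → .{{_ : NonZero a}} → a < b →
    (λs : List ℕ) → IsPartition λs →
    (μ : List ℕ) → IsPartition μ →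
    ((x y : ℕ) → 1 ≤ x → 1 ≤ y → InCr a b λs x y ⇔ InDiag μ x y) →
    ((i j : ℕ) → InDiag λs i j → b ∣ hook λs i j →
    ((+ b / a) - 1ℚ) * (+ leg λs i j / 1) <ℚ (+ (arm λs i j Data.Nat.+ 1) / 1)) →
    Regular b λs × MbTr b λs ≡ μ
theorem1p2 0 b {{nz}} a<b = ⊥-elim (≢-nonZero⁻¹ 0 {{nz}} refl)
theorem1p2 (suc a′) b a<b = go (m≤n⇒∃[o]m+o≡n a<b)
  where
  go : (∃ λ d′ → suc (suc a′) Data.Nat.+ d′ ≡ b) → RegularizationClaim (suc a′) b
  go (d′ , eq) = subst (λ b → RegularizationClaim (suc a′) b) (trans (+-suc (suc a′) d′) eq) (mullineux-regular a′ d′)
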